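{- There exist an absolute constant $C$, a labeling scheme, and a deterministic distributed algorithm using its labels such that, for every $k\ge 1$ and every instance of $k$-gathering on a radio network with diameter $D$ and maximum degree $\Delta\geq 1$, the labeling scheme has length at most $C\,(1+\min(\log\Delta,\log k))$ on this instance and the algorithm accomplishes $k$-gathering in at most $C\min(D+k,\,D\Delta)$ rounds. This label length is asymptotically optimal: there is an absolute constant $c>0$ such that for all $k\ge 1$ and $\Delta\ge 2$ there is an instance of $k$-gathering on a network of maximum degree $\Delta$ on which every labeling scheme permitting some deterministic distributed algorithm to accomplish $k$-gathering has length at least $c\min(\log\Delta,\log k)$.
   Context: Radio network: a finite simple undirected connected graph $G=(V,E)$. Computation proceeds in synchronous rounds. In each round every node either transmits a message to all its neighbors or listens. A node $v$ receives the message of a neighbor $w$ in a round iff $v$ listens in this round and $w$ is the only neighbor of $v$ transmitting in this round; otherwise $v$ receives nothing, and cannot tell whether any neighbor transmitted. There is no bound on message size, so several source messages may be combined in one transmission. $k$-gathering: an instance is a network with $k$ distinct nodes $s_1,\dots,s_k$ (sources), each holding a message, and a node $s$ (sink). All $k$ messages must reach $s$. Labeling scheme: assigns to each node of each instance a binary string (its label), possibly depending on the whole instance; labels need not be distinct. Its length is the maximum length of an assigned label. In a deterministic distributed algorithm all nodes run the same algorithm (the same for all instances); initially a node knows only its own label and, if it is a source, its message. Nodes know nothing else about the network. Source messages are opaque: the decision whether to transmit depends only on the label, on whether the node is a source, and on the history of receptions, and not on the contents of source messages. Non-spontaneous wake-up: only the sources start at round $0$; any other node joins only after receiving a message. The current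 round number may be attached to every message, so a node that has been woken up knows the global round number. All logarithms are to base 2. -}

module Defs where

open import Data.Bool.Base using (Bool; true; false; if_then_else_; _∨_; T)
open import Data.Bool.ListAction using (any)
open import Data.Fin.Base using (Fin)
open import Data.Fin.Properties using (any?) renaming (_≟_ to _≟ᶠ_)
open import Data.Integer.Base using (+_)
open import Data.List.Base as List
  using (List; []; _∷_; allFin; concatMap; filterᵇ; fromMaybe; length; mapMaybe)
open import Data.List.Extrema.Nat using (max)
open import Data.List.Membership.Propositional using (_∈_)
open import Data.Maybe.Base as Maybe using (Maybe; just; nothing; is-just)
open import Data.Nat.Base using (ℕ; zero; suc; _≤_)
open import Data.Product.Base using (_×_; ∃; ∃₂; proj₁)
open import Data.Rational.Base using (ℚ; _/_)
open import Function.Base using (_∘_)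
open import Function.Definitions using (Injective)
open import Relation.Binary.PropositionalEquality using (_≡_)
open import Relation.Nullary.Decidable.Core using (dec⇒maybe)

data Walk {n : ℕ} (adj : Fin n → Fin n → Bool) : ℕ → Fin n → Fin n → Set where
  nil  : ∀ {u} → Walk adj zero u u
  cons : ∀ {ℓ u v w} → T (adj u v) → Walk adj ℓ v w → Walk adj (suc ℓ) u w

record Network : Set where
  field
    size       : ℕ
    adj        : Fin size → Fin size → Bool
    adj-sym    : ∀ u v → adj u v ≡ adj v u
    adj-irrefl : ∀ v → adj v v ≡ false
    connected  : ∀ u v → ∃ λ ℓ → Walk adj ℓ u v

  Node : Set
  Node = Fin size

  nodes : List Node
  nodes = allFin size

  neighbours : Node → List Node
  neighbours v = filterᵇ (adj v) nodes

  degree : Node → ℕ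
  degree v = length (neighbours v)

  maxDegree : ℕ
  maxDegree = max 0 (List.map degree nodes)

  IsDistance : Node → Node → ℕ → Set
  IsDistance u v d = Walk adj d u v × (∀ ℓ → Walk adj ℓ u v → d ≤ ℓ)

  IsDiameter : ℕ → Set
  IsDiameter D =
    (∀ u v d → IsDistance u v d → d ≤ D) × ∃₂ λ u v → IsDistance u v D

-- The sink may itself be one of the sources.
record Instance (k : ℕ) : Set where
  field
    network : Network
  open Network network public
  field
    source           : Fin k → Node
    source-injective : Injective _≡_ _≡_ source
    sink             : Node

Label : Set
Label = List Bool

LabelingScheme : Set
LabelingScheme = ∀ {k} (I : Instance k) → Instance.Node I → Label

schemeLength : LabelingScheme → ∀ {k} → Instance k → ℕ
schemeLength scheme I = max 0 (List.map (length ∘ scheme I) (Instance.nodes I))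

-- A transmission: an arbitrary finite string of control information (round
-- numbers, labels, ...) together with any number of combined source messages,
-- each source message being an element of M.
record Message (M : Set) : Set where
  constructor message
  field
    control : List Bool
    payload : List M

mapMessage : ∀ {M N : Set} → (M → N) → Message M → Message N
mapMessage f (message c p) = message c (List.map f p)

-- One entry per elapsed round, most recent first; `nothing` records a round in
-- which nothing was received.  Its length is the global round number.
History : Set → Set
History M = List (Maybe (Message M))

mapHistory : ∀ {M N : Set} → (M → N) → History M → History N
mapHistory f = List.map (Maybe.map (mapMessage f))

-- `act label own history` is the message transmitted in the current round, or
-- `nothing` if the node listens; `own` is the node's source message, if any.
-- Opacity is naturality in the type of source messages.  Taking N = ⊤ shows that
-- whether a node transmits, and with which control string, depends only on the
-- label, on being a source, and on the history with source messages erased.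
-- Naturality also forces every source message sent to be one the node holds.
record Algorithm : Set₁ where
  field
    act : ∀ {M : Set} → Label → Maybe M → History M → Maybe (Message M)
    opaque-messages :
      ∀ {M N : Set} (f : M → N) (label : Label) (own : Maybe M) (h : History M) →
      act label (Maybe.map f own) (mapHistory f h)
        ≡ Maybe.map (mapMessage f) (act label own h)

-- What a listening node receives, given the messages its neighbours transmit.
reception : ∀ {A : Set} → List A → Maybe A
reception (m ∷ []) = just m
reception _        = nothing

module Execution (alg : Algorithm) {k : ℕ} (I : Instance k)
                 (label : Instance.Node I → Label) where
  open Instance I
  open Algorithm alg

  -- The message of the i-th source is represented by i : Fin k.
  ownMessage : Node → Maybe (Fin k)
  ownMessage v = Maybe.map proj₁ (dec⇒maybe (any? λ i → source i ≟ᶠ v))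

  -- Non-spontaneous wake-up: sources are awake from round 0, every other node
  -- from its first reception.
  awake : Node → History (Fin k) → Bool
  awake v h = is-just (ownMessage v) ∨ any is-just h

  action : Node → History (Fin k) → Maybe (Message (Fin k))
  action v h = if awake v h then act (label v) (ownMessage v) h else nothing

  hear : (Node → Maybe (Message (Fin k))) → Node → Maybe (Message (Fin k))
  hear sent v with sent v
  ... | just _  = nothing
  ... | nothing = reception (mapMaybe sent (neighbours v))

  -- `history t v` covers rounds 0, …, t - 1.
  history : ℕ → Node → History (Fin k)
  history zero    v = []
  history (suc t) v = hear (λ u → action u (history t u)) v ∷ history t v

  held : ℕ → Node → List (Fin k)
  held t v = fromMaybe (ownMessage v) List.++
             concatMap Message.payload (List.catMaybes (history t v))

  GathersWithin : ℕ → Set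
  GathersWithin t = ∀ i → i ∈ held t sink

  Gathers : Set
  Gathers = ∃ GathersWithin

open Execution public using (GathersWithin; Gathers)

fromℕ : ℕ → ℚ
fromℕ n = + n / 1

{-# OPTIONS --safe #-}
module Submission where

-- Upper bound. Let m be the minimum of Δ and k. Sending every node other than
-- the sink to its first neighbour that is closer to the sink gives a
-- breadth-first tree; a node other than the sink is active if a tree path from
-- a source to the sink passes it. Every active node transmits exactly once,
-- sending all that it holds, in a round after its children have transmitted and
-- in which its parent hears it, so that the sink finally holds all messages. A
-- node need not know its round: an active node without active children is a
-- source and transmits after O(m) rounds, and any other active node waits for
-- one child, recognised by its colour, and transmits after a delay written in
-- its label. Labels are short because colours and delays are O(m)
-- (label-short).
--
-- Let T v be the round in which v transmits (transmission). T v + dist v is a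
-- multiple of 3, so only nodes in the same layer interfere. Within a layer
-- there are slots 0, …, m - 1 such that the parent of v is adjacent to no other
-- active node of the layer of v with the slot of v (slot-separates). They are
-- found greedily in the order of the parents: the nodes that received slots
-- before v and disturb v are adjacent to its parent, since parents are first
-- choices, and there are at most k active nodes in a layer.
--
-- The witness of v is the deepest source below v, ties being broken by a rank
-- ρ < k which refines the order by depth, and the height of v is its distance
-- from its witness. Let h be k / m rounded down, plus 1. Nodes of height less
-- than h transmit in the slots of consecutive windows of O(m) rounds. At larger
-- heights messages move one layer per round, and T v + dist v depends only on
-- the witness, increases with ρ, and is odd whereas it is even for small
-- heights; so there is no interference. The arrival at height h in the order of
-- the ranks requires an additional wait of about 6 * ρ rounds, which does not
-- fit into a single label: it is distributed over the path below, on which one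
-- window is skipped at each of the first ρ / m < h steps (time-mono,
-- time-step). A node of height j < h transmits within O(m * (j + 1)) rounds,
-- which is both O(m * D) and O(m * h) = O(k). A node of height at least h
-- transmits within O(k + D) rounds, and if there is one, then D > h and hence
-- k < m * D (time<D+k, time<D*m).
--
-- Lower bound. Two sources with the same neighbours and the same label act
-- alike, because the algorithm does not see the contents of messages; hence
-- their messages always collide (twin-message-stays). So in a star all source
-- leaves need distinct labels. If k > Δ, a path is attached to one leaf to make
-- room for the remaining sources; there the other leaves still need distinct
-- labels, all nodes are sources, and some label must be nonempty as otherwise
-- all nodes always act alike (uniform-message-stays). As there are fewer than 2
-- ^ (L + 1) labels of length at most L, the bound follows (distinct-labels).

open import Defs
open import Data.Nat using (ℕ; _≤_; _+_; _*_; _⊓_)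
open import Data.Nat.Logarithm using (⌊log₂_⌋; ⌈log₂_⌉)
open import Data.Product using (Σ; _×_)
open import Data.Rational using (ℚ; 0ℚ) renaming (_<_ to _<ℚ_; _≤_ to _≤ℚ_; _*_ to _*ℚ_)
open import Relation.Binary.PropositionalEquality using (_≡_)
open import Data.Bool.Base using (Bool; true; false; if_then_else_; T)
open import Data.Bool.ListAction using (any)
import Data.Bool.Properties as Bool
open import Data.Empty using (⊥; ⊥-elim)
open import Data.Fin.Base using (Fin; zero; suc; toℕ; fromℕ<)
open import Data.Fin.Properties using (toℕ<n; toℕ-injective; injective⇒≤; any?; toℕ-fromℕ<) renaming (_≟_ to _≟ᶠ_)
import Data.Integer.Base as ℤ
import Data.Integer.Properties as ℤ
open import Data.List.Base using (List; []; _∷_; _++_; allFin; filter; filterᵇ; length; lookup; map; mapMaybe; catMaybes; concatMap; fromMaybe; upTo)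
open import Data.List.Extrema.Nat using (max; argmax; argmin; f[xs]≤f[argmax]; f[argmin]≤f[xs]; xs≤max; max≤v⁺)
open import Data.List.Membership.Propositional using (_∈_; _∉_)
open import Data.List.Membership.Propositional.Properties using (∈-lookup; ∈-allFin; ∈-filter⁺; ∈-filter⁻; ∈-map⁺; ∈-map⁻; ∈-++⁺ˡ; ∈-++⁺ʳ; ∈-++⁻; ∈-upTo⁺; ∈-upTo⁻)
open import Data.List.Properties using (length-map; length-tabulate; length-++; map-++)
import Data.List.Properties as List
open import Data.List.Relation.Unary.All as All using (All; []; _∷_)
import Data.List.Relation.Unary.All.Properties as All
open import Data.List.Relation.Unary.AllPairs using ([]; _∷_)
open import Data.List.Relation.Unary.Any using (here; there; index)
open import Data.List.Relation.Unary.Any.Properties using (lookup-index)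
open import Data.List.Relation.Unary.Unique.Propositional using (Unique)
import Data.List.Relation.Unary.Unique.Propositional.Properties as Unique
open import Data.Maybe.Base as Maybe using (Maybe; just; nothing; is-just)
import Data.Maybe.Properties as Maybe
open import Data.Nat.Base using (zero; suc; _<_; z≤n; s≤s; _∸_; pred; _^_; NonZero; >-nonZero; ≢-nonZero)
open import Data.Nat.Binary.Base as ℕᵇ using (ℕᵇ; 2[1+_]; 1+[2_])
import Data.Nat.Binary.Properties as ℕᵇ
open import Data.Nat.DivMod using (_/_; _%_; m≡m%n+[m/n]*n; m%n<n; m/n*n≤m; /-monoˡ-≤; [m+kn]%n≡m%n; m<n⇒m%n≡m)
open import Data.Nat.Induction using (<-rec)
open import Data.Nat.Logarithm using (⌊log₂⌋-mono-≤; ⌊log₂[2^n]⌋≡n; ⌊log₂[2*b]⌋≡1+⌊log₂b⌋; ⌈log₂⌉-mono-≤; ⌈log₂2^n⌉≡n)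
open import Data.Nat.Properties
open import Data.Nat.Tactic.RingSolver using (solve-∀)
open import Data.Product using (_,_; proj₁; proj₂; ∃; ∃₂)
open import Data.Rational.Base using (½; toℚᵘ)
import Data.Rational.Properties as ℚ
open import Data.Rational.Unnormalised.Base as ℚᵘ using (mkℚᵘ; *≤*)
import Data.Rational.Unnormalised.Properties as ℚᵘ
open import Data.Sum using (_⊎_; inj₁; inj₂; [_,_]′)
open import Data.Unit using (tt)
open import Function using (_∘_; id; const; case_of_)
open import Relation.Binary.Definitions using (tri<; tri≈; tri>)
open import Relation.Binary.PropositionalEquality using (_≢_; refl; sym; trans; cong; cong₂; subst; module ≡-Reasoning)
open import Relation.Nullary using (¬_; Dec; yes; no; does)
open import Relation.Nullary.Decidable using (_×-dec_; _⊎-dec_; ¬?; dec-true; dec-false; decidable-stable; map′; T?)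

-- Decisions, finite sets and lists

if-yes : ∀ {P A : Set} (P? : Dec P) {x y : A} → P → (if does P? then x else y) ≡ x
if-yes P? p rewrite dec-true P? p = refl

if-no : ∀ {P A : Set} (P? : Dec P) {x y : A} → ¬ P → (if does P? then x else y) ≡ y
if-no P? ¬p rewrite dec-false P? ¬p = refl

lookup-unique-injective : ∀ {A : Set} {xs : List A} → Unique xs →
  ∀ {i j} → lookup xs i ≡ lookup xs j → i ≡ j
lookup-unique-injective (_ ∷ _)      {zero}  {zero}  _  = refl
lookup-unique-injective (x∉ ∷ _)     {zero}  {suc j} eq =
  ⊥-elim (All.lookup x∉ (∈-lookup j) eq)
lookup-unique-injective (x∉ ∷ _)     {suc i} {zero}  eq =
  ⊥-elim (All.lookup x∉ (∈-lookup i) (sym eq))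
lookup-unique-injective (_ ∷ unique) {suc i} {suc j} eq =
  cong suc (lookup-unique-injective unique eq)

unique-⊆⇒length≤ : ∀ {A : Set} {xs ys : List A} → Unique xs →
  (∀ {x} → x ∈ xs → x ∈ ys) → length xs ≤ length ys
unique-⊆⇒length≤ {xs = xs} {ys} unique sub =
  injective⇒≤ {f = position} (λ {i} {j} eq → lookup-unique-injective unique (begin
    lookup xs i             ≡⟨ lookup-index (sub (∈-lookup i)) ⟩
    lookup ys (position i)  ≡⟨ cong (lookup ys) eq ⟩
    lookup ys (position j)  ≡⟨ lookup-index (sub (∈-lookup j)) ⟨
    lookup xs j             ∎))
  where
  open ≡-Reasoning
  position : Fin (length xs) → Fin (length ys)
  position i = index (sub (∈-lookup i))

length-allFin : ∀ n → length (allFin n) ≡ n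
length-allFin n = length-tabulate id

-- Among 0, …, length xs some number is missing from xs.
missing : (xs : List ℕ) → ∃ λ a → a ≤ length xs × a ∉ xs
missing xs with any? (λ (i : Fin (suc (length xs))) → ¬? (toℕ i ∈? xs))
  where open import Data.List.Membership.DecPropositional _≟_ using (_∈?_)
... | yes (i , i∉xs) = toℕ i , ≤-pred (toℕ<n i) , i∉xs
... | no ∀i∈xs = ⊥-elim (1+n≰n (begin
  suc (length xs)
      ≡⟨ sym (trans (length-map toℕ (allFin (suc (length xs)))) (length-allFin _)) ⟩
  length (map toℕ (allFin (suc (length xs))))
      ≤⟨ unique-⊆⇒length≤ (Unique.map⁺ toℕ-injective (Unique.allFin⁺ _)) inside ⟩
  length xs                                      ∎))
  where
  open ≤-Reasoning
  open import Data.List.Membership.DecPropositional _≟_ using (_∈?_)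
  inside : ∀ {a} → a ∈ map toℕ (allFin (suc (length xs))) → a ∈ xs
  inside {a} a∈ with a ∈? xs | ∈-map⁻ toℕ a∈
  ... | yes a∈xs | _ = a∈xs
  ... | no a∉xs  | i , _ , a≡ = ⊥-elim (∀i∈xs (i , subst (_∉ xs) a≡ a∉xs))

least : {P : ℕ → Set} → (∀ n → Dec (P n)) → ∃ P →
  ∃ λ m → P m × (∀ n → P n → m ≤ n)
least {P} P? (n , p) = go P? n p
  where
  go : {P : ℕ → Set} → (∀ n → Dec (P n)) → ∀ n → P n →
    ∃ λ m → P m × (∀ n → P n → m ≤ n)
  go P? zero p = zero , p , λ _ _ → z≤n
  go P? (suc n) p with P? zero
  ... | yes p₀ = zero , p₀ , λ _ _ → z≤n
  ... | no ¬p₀ with go (P? ∘ suc) n p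
  ...   | m , pm , minimal = suc m , pm ,
          λ { zero p₀ → ⊥-elim (¬p₀ p₀) ; (suc n) pn → s≤s (minimal n pn) }

-- Greedy colouring: the elements are coloured by increasing key, and v avoids
-- the colours of the elements u with smaller key and Q v u.  If these are
-- always fewer than m, then m colours suffice.
module _ {n : ℕ} (key : Fin n → ℕ) (key-injective : ∀ {u v} → key u ≡ key v → u ≡ v)
         {Q : Fin n → Fin n → Set} (Q? : ∀ v u → Dec (Q v u)) where

  avoided : Fin n → List (Fin n)
  avoided v = filter (λ u → (key u <? key v) ×-dec Q? v u) (allFin n)

  greedy : ∀ m → (∀ v → length (avoided v) < m) →
    ∃ λ (σ : Fin n → ℕ) → (∀ v → σ v < m) × (∀ {u v} → key u < key v → Q v u → σ u ≢ σ v)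
  greedy m few with below (suc (max 0 (map key (allFin n))))
    where
    -- All elements with key less than t are coloured.
    Partial : ℕ → (Fin n → ℕ) → Set
    Partial t σ = (∀ v → σ v < m) ×
      (∀ {u v} → key v < t → key u < key v → Q v u → σ u ≢ σ v)
    below : ∀ t → ∃ (Partial t)
    below zero = const 0 , (λ v → ≤-<-trans z≤n (few v)) , λ ()
    below (suc t) with below t | any? (λ v → key v ≟ t)
    ... | σ , bound , proper | no none = σ , bound , proper′
      where
      proper′ : ∀ {u v} → key v < suc t → key u < key v → Q v u → σ u ≢ σ v
      proper′ {v = v} v<1+t with m≤n⇒m<n∨m≡n (≤-pred v<1+t)
      ... | inj₁ v<t = proper v<t
      ... | inj₂ v≡t = ⊥-elim (none (v , v≡t))
    ... | σ , bound , proper | yes (w , w≡t) with missing (map σ (avoided w))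
    ...   | a , a≤ , a∉ = σ′ , bound′ , proper′
      where
      σ′ : Fin n → ℕ
      σ′ v = if does (v ≟ᶠ w) then a else σ v
      σ′-other : ∀ v → v ≢ w → σ′ v ≡ σ v
      σ′-other v v≢w = if-no (v ≟ᶠ w) v≢w
      bound′ : ∀ v → σ′ v < m
      bound′ v with v ≟ᶠ w
      ... | yes _ = ≤-<-trans (≤-trans a≤ (≤-reflexive (length-map σ (avoided w)))) (few w)
      ... | no _  = bound v
      proper′ : ∀ {u v} → key v < suc t → key u < key v → Q v u → σ′ u ≢ σ′ v
      proper′ {u} {v} v<1+t u<v q with v ≟ᶠ w
      ... | yes v≡w = λ eq → a∉ (subst (_∈ map σ (avoided w)) (trans (sym (σ′-other u u≢w)) eq)
                (∈-map⁺ σ (∈-filter⁺ _ (∈-allFin u) (subst (λ x → key u < key x × Q x u) v≡w (u<v , q)))))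
        where
        u≢w : u ≢ w
        u≢w u≡w = <-irrefl (cong key (trans u≡w (sym v≡w))) u<v
      ... | no v≢w with m≤n⇒m<n∨m≡n (≤-pred v<1+t)
      ...   | inj₂ v≡t = ⊥-elim (v≢w (key-injective (trans v≡t (sym w≡t))))
      ...   | inj₁ v<t = λ eq → proper v<t u<v q (trans (sym (σ′-other u u≢w)) eq)
        where
        u≢w : u ≢ w
        u≢w u≡w = <-asym u<v (subst (key v <_) (trans (sym w≡t) (cong key (sym u≡w))) v<t)
  ... | σ , bound , proper = σ , bound , proper (s≤s (All.lookup (xs≤max 0 _) (∈-map⁺ key (∈-allFin _))))

-- The rank of i is the number of elements with a smaller key.
module _ {n : ℕ} (key : Fin n → ℕ) where

  private
    smaller : Fin n → List (Fin n)
    smaller i = filter (λ j → key j <? key i) (allFin n)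

  rank : Fin n → ℕ
  rank i = length (smaller i)

  private
    smaller-unique : ∀ i → Unique (i ∷ smaller i)
    smaller-unique i =
      All.tabulate (λ j∈ i≡j → <-irrefl (cong key (sym i≡j))
          (proj₂ (∈-filter⁻ (λ j → key j <? key i) {xs = allFin n} j∈)))
      ∷ Unique.filter⁺ _ (Unique.allFin⁺ n)

  rank<n : ∀ i → rank i < n
  rank<n i = ≤-trans (unique-⊆⇒length≤ (smaller-unique i) (λ _ → ∈-allFin _))
      (≤-reflexive (length-allFin n))

  rank-mono-< : ∀ {i j} → key i < key j → rank i < rank j
  rank-mono-< {i} {j} i<j = unique-⊆⇒length≤ (smaller-unique i) inside
    where
    inside : ∀ {x} → x ∈ i ∷ smaller i → x ∈ smaller j
    inside (here refl) = ∈-filter⁺ _ (∈-allFin _) i<j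
    inside (there x∈)  = ∈-filter⁺ _ (∈-allFin _)
      (<-trans (proj₂ (∈-filter⁻ (λ x → key x <? key i) {xs = allFin n} x∈)) i<j)

  rank-cancel-≤ : ∀ {i j} → rank i ≤ rank j → key i ≤ key j
  rank-cancel-≤ {i} {j} ri≤rj = ≮⇒≥ (λ j<i → <⇒≱ (rank-mono-< j<i) ri≤rj)

-- Self-delimiting binary code

-- The digits of the bijective binary numeral of n, each preceded by true, and
-- a final false.
encode : ℕᵇ → List Bool
encode ℕᵇ.zero  = false ∷ []
encode 2[1+ x ] = true ∷ true ∷ encode x
encode 1+[2 x ] = true ∷ false ∷ encode x

code : ℕ → List Bool
code n = encode (ℕᵇ.fromℕ n)

-- Reads one code word and returns the rest of the string.  On strings which do
-- not start with a code word the value is irrelevant.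
decode : List Bool → ℕᵇ × List Bool
decode (true ∷ true ∷ bs)  = let (x , rest) = decode bs in 2[1+ x ] , rest
decode (true ∷ false ∷ bs) = let (x , rest) = decode bs in 1+[2 x ] , rest
decode (true ∷ [])         = ℕᵇ.zero , []
decode (false ∷ bs)        = ℕᵇ.zero , bs
decode []                  = ℕᵇ.zero , []

read : List Bool → ℕ × List Bool
read bs = let (x , rest) = decode bs in ℕᵇ.toℕ x , rest

decode-encode : ∀ x rest → decode (encode x ++ rest) ≡ (x , rest)
decode-encode ℕᵇ.zero  rest = refl
decode-encode 2[1+ x ] rest rewrite decode-encode x rest = refl
decode-encode 1+[2 x ] rest rewrite decode-encode x rest = refl

decode-encode-last : ∀ x → decode (encode x) ≡ (x , [])
decode-encode-last x = trans (cong decode (sym (List.++-identityʳ (encode x)))) (decode-encode x [])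

code-injective : ∀ {m n} → code m ≡ code n → m ≡ n
code-injective {m} {n} eq = begin
  m                           ≡⟨ ℕᵇ.toℕ-fromℕ m ⟨
  ℕᵇ.toℕ (ℕᵇ.fromℕ m)         ≡⟨ cong (proj₁ ∘ read-with) (decode-encode-last (ℕᵇ.fromℕ m)) ⟨
  proj₁ (read (code m))       ≡⟨ cong (proj₁ ∘ read) eq ⟩
  proj₁ (read (code n))       ≡⟨ cong (proj₁ ∘ read-with) (decode-encode-last (ℕᵇ.fromℕ n)) ⟩
  ℕᵇ.toℕ (ℕᵇ.fromℕ n)         ≡⟨ ℕᵇ.toℕ-fromℕ n ⟩
  n                           ∎
  where
  open ≡-Reasoning
  read-with : ℕᵇ × List Bool → ℕ × List Bool
  read-with (x , rest) = ℕᵇ.toℕ x , rest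

digits : ℕᵇ → ℕ
digits ℕᵇ.zero  = 0
digits 2[1+ x ] = suc (digits x)
digits 1+[2 x ] = suc (digits x)

length-encode : ∀ x → length (encode x) ≡ 1 + 2 * digits x
length-encode ℕᵇ.zero  = refl
length-encode 2[1+ x ] rewrite length-encode x | *-suc 2 (digits x) = refl
length-encode 1+[2 x ] rewrite length-encode x | *-suc 2 (digits x) = refl

2^digits≤1+n : ∀ x → 2 ^ digits x ≤ suc (ℕᵇ.toℕ x)
2^digits≤1+n ℕᵇ.zero  = s≤s z≤n
2^digits≤1+n 2[1+ x ] = m≤n⇒m≤1+n (*-monoʳ-≤ 2 (2^digits≤1+n x))
2^digits≤1+n 1+[2 x ] = ≤-trans (*-monoʳ-≤ 2 (2^digits≤1+n x)) (≤-reflexive (*-suc 2 (ℕᵇ.toℕ x)))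

length-code : ∀ n → length (code n) ≤ 1 + 2 * ⌊log₂ suc n ⌋
length-code n = begin
  length (code n)                  ≡⟨ length-encode (ℕᵇ.fromℕ n) ⟩
  1 + 2 * d                        ≡⟨ cong (λ x → 1 + 2 * x) (⌊log₂[2^n]⌋≡n d) ⟨
  1 + 2 * ⌊log₂ 2 ^ d ⌋            ≤⟨ s≤s (*-monoʳ-≤ 2 (⌊log₂⌋-mono-≤ (2^digits≤1+n (ℕᵇ.fromℕ n)))) ⟩
  1 + 2 * ⌊log₂ suc (ℕᵇ.toℕ (ℕᵇ.fromℕ n)) ⌋ ≡⟨ cong (λ x → 1 + 2 * ⌊log₂ suc x ⌋) (ℕᵇ.toℕ-fromℕ n) ⟩
  1 + 2 * ⌊log₂ suc n ⌋            ∎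
  where
  open ≤-Reasoning
  d = digits (ℕᵇ.fromℕ n)

-- The gathering algorithm

-- What a label tells its node: never to transmit; to transmit its colour γ in
-- round t; or to transmit its colour γ in every round such that d + 1 rounds
-- earlier a message from a node of colour α was received.
data Role : Set where
  silent  : Role
  starter : (γ t : ℕ) → Role
  relay   : (α γ d : ℕ) → Role

toLabel : Role → Label
toLabel silent        = []
toLabel (starter γ t) = true ∷ code γ ++ code t
toLabel (relay α γ d) = false ∷ code α ++ code γ ++ code d

fromLabel : Label → Role
fromLabel []           = silent
fromLabel (true ∷ bs)  =
  let (γ , bs₁) = read bs; (t , _) = read bs₁ in starter γ t
fromLabel (false ∷ bs) =
  let (α , bs₁) = read bs; (γ , bs₂) = read bs₁; (d , _) = read bs₂ in relay α γ d

fromLabel-toLabel : ∀ role → fromLabel (toLabel role) ≡ role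
fromLabel-toLabel silent = refl
fromLabel-toLabel (starter γ t)
  rewrite decode-encode (ℕᵇ.fromℕ γ) (code t) | decode-encode-last (ℕᵇ.fromℕ t)
        | ℕᵇ.toℕ-fromℕ γ | ℕᵇ.toℕ-fromℕ t = refl
fromLabel-toLabel (relay α γ d)
  rewrite decode-encode (ℕᵇ.fromℕ α) (code γ ++ code d) | decode-encode (ℕᵇ.fromℕ γ) (code d)
        | decode-encode-last (ℕᵇ.fromℕ d)
        | ℕᵇ.toℕ-fromℕ α | ℕᵇ.toℕ-fromℕ γ | ℕᵇ.toℕ-fromℕ d = refl

-- The control string received d + 1 rounds ago.
heard : ∀ {M : Set} → ℕ → History M → Maybe (List Bool)
heard _       []      = nothing
heard zero    (x ∷ h) = Maybe.map Message.control x
heard (suc d) (x ∷ h) = heard d h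

infix 4 _≟ᶜ_
_≟ᶜ_ : (x y : Maybe (List Bool)) → Dec (x ≡ y)
_≟ᶜ_ = Maybe.≡-dec (List.≡-dec Bool._≟_)

-- The control string to be transmitted now, if any.
fires : ∀ {M : Set} → Role → History M → Maybe (List Bool)
fires silent        h = nothing
fires (starter γ t) h = if does (length h ≟ t) then just (code γ) else nothing
fires (relay α γ d) h = if does (heard d h ≟ᶜ just (code α)) then just (code γ) else nothing

-- The source messages that a node with this history holds.
known : ∀ {M : Set} → Maybe M → History M → List M
known own h = fromMaybe own ++ concatMap Message.payload (catMaybes h)

-- A transmitting node sends its colour and all source messages that it holds.
transmit : ∀ {M : Set} → Label → Maybe M → History M → Maybe (Message M)
transmit label own h = Maybe.map (λ c → message c (known own h)) (fires (fromLabel label) h)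

heard-natural : ∀ {M N : Set} (f : M → N) d h → heard d (mapHistory f h) ≡ heard d h
heard-natural f d       []             = refl
heard-natural f zero    (nothing ∷ h)  = refl
heard-natural f zero    (just _ ∷ h)   = refl
heard-natural f (suc d) (x ∷ h)        = heard-natural f d h

fires-natural : ∀ {M N : Set} (f : M → N) role h → fires role (mapHistory f h) ≡ fires role h
fires-natural f silent        h = refl
fires-natural f (starter γ t) h rewrite length-map (Maybe.map (mapMessage f)) h = refl
fires-natural f (relay α γ d) h rewrite heard-natural f d h = refl

known-natural : ∀ {M N : Set} (f : M → N) own h →
  known (Maybe.map f own) (mapHistory f h) ≡ map f (known own h)
known-natural f own h = trans (cong₂ _++_ (own-natural own) (received-natural h))
                              (sym (map-++ f (fromMaybe own) _))
  where
  own-natural : ∀ own → fromMaybe (Maybe.map f own) ≡ map f (fromMaybe own)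
  own-natural nothing  = refl
  own-natural (just _) = refl
  received-natural : ∀ h → concatMap Message.payload (catMaybes (mapHistory f h))
                         ≡ map f (concatMap Message.payload (catMaybes h))
  received-natural []            = refl
  received-natural (nothing ∷ h) = received-natural h
  received-natural (just m ∷ h)  =
    trans (cong (map f (Message.payload m) ++_) (received-natural h))
          (sym (map-++ f (Message.payload m) _))

transmit-natural : ∀ {M N : Set} (f : M → N) label own h →
  transmit label (Maybe.map f own) (mapHistory f h) ≡ Maybe.map (mapMessage f) (transmit label own h)
transmit-natural f label own h rewrite fires-natural f (fromLabel label) h | known-natural f own h
  with fires (fromLabel label) h
... | nothing = refl
... | just _  = refl

relaying : Algorithm
relaying = record { act = transmit ; opaque-messages = transmit-natural }

-- Reception

module _ {A B : Set} {sent : A → Maybe B} where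

  private
    all-silent : ∀ xs → (∀ {z} → z ∈ xs → sent z ≡ nothing) → mapMaybe sent xs ≡ []
    all-silent []       quiet = refl
    all-silent (x ∷ xs) quiet rewrite quiet (here refl) = all-silent xs (quiet ∘ there)

    none-sent : ∀ xs → mapMaybe sent xs ≡ [] → ∀ {z} → z ∈ xs → sent z ≡ nothing
    none-sent (x ∷ xs) eq z∈ with sent x in sx
    none-sent (x ∷ xs) eq (here refl) | nothing = sx
    none-sent (x ∷ xs) eq (there z∈)  | nothing = none-sent xs eq z∈

  reception⁺ : ∀ {xs y μ} → Unique xs → y ∈ xs → sent y ≡ just μ →
    (∀ {z} → z ∈ xs → z ≢ y → sent z ≡ nothing) → reception (mapMaybe sent xs) ≡ just μ
  reception⁺ {x ∷ xs} (x∉ ∷ _) (here refl) sy alone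
    rewrite sy | all-silent xs (λ z∈ → alone (there z∈) (λ z≡x → All.lookup x∉ z∈ (sym z≡x))) = refl
  reception⁺ {x ∷ xs} (x∉ ∷ unique) (there y∈) sy alone
    rewrite alone (here refl) (All.lookup x∉ y∈) = reception⁺ unique y∈ sy (alone ∘ there)

  reception⁻ : ∀ {xs μ} → reception (mapMaybe sent xs) ≡ just μ →
    ∃ λ y → y ∈ xs × sent y ≡ just μ × (∀ {z} → z ∈ xs → z ≢ y → sent z ≡ nothing)
  reception⁻ {x ∷ xs} eq with sent x in sx
  ... | nothing = let (y , y∈ , sy , alone) = reception⁻ {xs} eq in
        y , there y∈ , sy , λ { (here refl) _ → sx ; (there z∈) → alone z∈ }
  ... | just ν with mapMaybe sent xs in rest
  reception⁻ {x ∷ xs} refl | just ν | [] =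
        x , here refl , sx ,
        λ { (here refl) z≢x → ⊥-elim (z≢x refl) ; (there z∈) _ → none-sent xs rest z∈ }

-- Executions

module NetworkProperties (N : Network) where
  open Network N

  ∈-neighbours⁺ : ∀ {u v} → T (adj v u) → u ∈ neighbours v
  ∈-neighbours⁺ {u} {v} uv = ∈-filter⁺ (T? ∘ adj v) (∈-allFin u) uv

  ∈-neighbours⁻ : ∀ {u v} → u ∈ neighbours v → T (adj v u)
  ∈-neighbours⁻ {v = v} u∈ = proj₂ (∈-filter⁻ (T? ∘ adj v) {xs = allFin size} u∈)

  neighbours-unique : ∀ v → Unique (neighbours v)
  neighbours-unique v = Unique.filter⁺ (T? ∘ adj v) (Unique.allFin⁺ size)

  T-sym : ∀ {u v} → T (adj u v) → T (adj v u)
  T-sym {u} {v} = subst T (adj-sym u v)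

  degree≤maxDegree : ∀ v → degree v ≤ maxDegree
  degree≤maxDegree v = All.lookup (xs≤max 0 (map degree nodes)) (∈-map⁺ degree (∈-allFin v))

is-just-any : ∀ {A : Set} {x : A} {xs : List (Maybe A)} → just x ∈ xs → any is-just xs ≡ true
is-just-any {xs = .(just _) ∷ _} (here refl)       = refl
is-just-any {xs = nothing ∷ _}   (there x∈)        = is-just-any x∈
is-just-any {xs = just _ ∷ _}    (there x∈)        = refl

module ExecutionProperties (alg : Algorithm) {k : ℕ} (I : Instance k)
                           (label : Instance.Node I → Label) where
  open Instance I
  open Algorithm alg
  open Execution alg I label hiding (GathersWithin; Gathers) public
  open NetworkProperties network

  sent : ℕ → Node → Maybe (Message (Fin k))
  sent t v = action v (history t v)

  received : ℕ → Node → Maybe (Message (Fin k))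
  received t = hear (sent t)

  length-history : ∀ t v → length (history t v) ≡ t
  length-history zero    v = refl
  length-history (suc t) v = cong suc (length-history t v)

  received⁺ : ∀ {t u v μ} → sent t v ≡ nothing → T (adj v u) → sent t u ≡ just μ →
    (∀ {w} → T (adj v w) → w ≢ u → sent t w ≡ nothing) → received t v ≡ just μ
  received⁺ {t} {u} {v} listens vu su alone with sent t v | listens
  ... | nothing | refl =
    reception⁺ (neighbours-unique v) (∈-neighbours⁺ vu) su (λ w∈ → alone (∈-neighbours⁻ w∈))

  received⁻ : ∀ {t v μ} → received t v ≡ just μ →
    ∃ λ u → T (adj v u) × sent t u ≡ just μ × (∀ {w} → T (adj v w) → w ≢ u → sent t w ≡ nothing)
  received⁻ {t} {v} eq with sent t v
  ... | nothing = let (u , u∈ , su , alone) = reception⁻ {xs = neighbours v} eq in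
        u , ∈-neighbours⁻ u∈ , su , alone ∘ ∈-neighbours⁺

  own-source : ∀ i → ownMessage (source i) ≡ just i
  own-source i with any? (λ j → source j ≟ᶠ source i)
  ... | yes (j , eq) = cong just (source-injective eq)
  ... | no none      = ⊥-elim (none (i , refl))

  own⁻ : ∀ {v i} → ownMessage v ≡ just i → source i ≡ v
  own⁻ {v} eq with any? (λ j → source j ≟ᶠ v)
  own⁻ refl | yes (j , sj≡v) = sj≡v

  sent⇒act : ∀ {t v μ} → sent t v ≡ just μ → act (label v) (ownMessage v) (history t v) ≡ just μ
  sent⇒act {t} {v} eq with awake v (history t v)
  ... | true = eq

  awake-sent : ∀ {t v} → awake v (history t v) ≡ true →
    sent t v ≡ act (label v) (ownMessage v) (history t v)
  awake-sent wake rewrite wake = refl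

  source-awake : ∀ {v h} i → source i ≡ v → awake v h ≡ true
  source-awake i refl rewrite own-source i = refl

  receiver-awake : ∀ {v h μ} → just μ ∈ h → awake v h ≡ true
  receiver-awake {v} {h} μ∈ rewrite is-just-any μ∈ = Bool.∨-zeroʳ (is-just (ownMessage v))

  received∈history : ∀ {s t v μ} → s < t → received s v ≡ just μ → just μ ∈ history t v
  received∈history {t = suc t} s<t eq with m≤n⇒m<n∨m≡n (≤-pred s<t)
  ... | inj₁ s<t′ = there (received∈history s<t′ eq)
  ... | inj₂ refl = here (sym eq)

  payload⊆known : ∀ {M : Set} {x : M} {μ} {h : History M} own →
    just μ ∈ h → x ∈ Message.payload μ → x ∈ known own h
  payload⊆known {h = h} own μ∈ x∈ = ∈-++⁺ʳ (fromMaybe own) (go h μ∈)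
    where
    go : ∀ h → just _ ∈ h → _ ∈ concatMap Message.payload (catMaybes h)
    go (just μ ∷ h)  (here refl) = ∈-++⁺ˡ x∈
    go (just ν ∷ h)  (there μ∈)  = ∈-++⁺ʳ (Message.payload ν) (go h μ∈)
    go (nothing ∷ h) (there μ∈)  = go h μ∈

  source-held : ∀ {t} i → i ∈ held t (source i)
  source-held i rewrite own-source i = here refl

if-just⁻ : ∀ {P A : Set} (P? : Dec P) {x y : A} →
  (if does P? then just x else nothing) ≡ just y → P × x ≡ y
if-just⁻ (yes p) refl = p , refl

-- Schedules

module _ {k : ℕ} (I : Instance k) where
  open Instance I

  -- In a schedule, every active node transmits exactly once, in round time v.
  -- It is a source that knows this round, or its transmission is triggered by
  -- that of a child u.  The parent of an active node hears it because no other
  -- active neighbour transmits in the same round, and recognises it because no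
  -- other active neighbour has the same colour.
  module Scheduled
      (Active : Node → Set) (active? : ∀ v → Dec (Active v))
      (parent : Node → Node) (time colour : Node → ℕ) (role : Node → Role)
      (role-inactive : ∀ {v} → ¬ Active v → role v ≡ silent)
      (role-active : ∀ {v} → Active v →
        (∃ λ i → source i ≡ v × role v ≡ starter (colour v) (time v))
        ⊎ (∃₂ λ u d → Active u × parent u ≡ v × time v ≡ suc d + time u
                      × role v ≡ relay (colour u) (colour v) d))
      (parent-adjacent : ∀ {u} → Active u → T (adj u (parent u)))
      (parent-listens : ∀ {u} → Active u → Active (parent u) → time (parent u) ≢ time u)
      (time-separates : ∀ {u w} → Active u → Active w → T (adj w (parent u)) → time w ≡ time u → w ≡ u)
      (colour-separates : ∀ {u w} → Active u → Active w → T (adj w (parent u)) → colour w ≡ colour u →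
          w ≡ u)
    where

    label : Node → Label
    label = toLabel ∘ role

    open ExecutionProperties relaying I label
    open NetworkProperties network

    -- In round t, node v transmits if and only if it is scheduled for this round.
    record Spec (t : ℕ) (v : Node) : Set where
      field
        only-then : ∀ {μ} → sent t v ≡ just μ →
          Active v × time v ≡ t × Message.control μ ≡ code (colour v)
        then-sends : Active v → time v ≡ t → ∃ λ μ → sent t v ≡ just μ
    open Spec

    private
      acts : ∀ {t v μ} → sent t v ≡ just μ → ∃ λ c → fires (role v) (history t v) ≡ just c
        × μ ≡ message c (held t v)
      acts {t} {v} eq = go (subst
          (λ r → Maybe.map (λ c → message c (held t v)) (fires r (history t v)) ≡ just _)
                              (fromLabel-toLabel (role v)) (sent⇒act eq))
        where
        go : ∀ {μ} {m : Maybe (List Bool)} → Maybe.map (λ c → message c (held t v)) m ≡ just μ →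
             ∃ λ c → m ≡ just c × μ ≡ message c (held t v)
        go {m = just c} refl = c , refl , refl

      sends : ∀ {t v c} → awake v (history t v) ≡ true → fires (role v) (history t v) ≡ just c →
        sent t v ≡ just (message c (held t v))
      sends {t} {v} {c} wake eq = trans (awake-sent wake)
        (trans (cong (λ r → Maybe.map (λ c → message c (held t v)) (fires r (history t v)))
            (fromLabel-toLabel (role v)))
               (cong (Maybe.map (λ c → message c (held t v))) eq))

      is-nothing : ∀ {A : Set} (m : Maybe A) → (∀ {x} → m ≡ just x → ⊥) → m ≡ nothing
      is-nothing nothing  _    = refl
      is-nothing (just x) none = ⊥-elim (none refl)

    -- The parent of an active node hears it.
    parent-receives : ∀ {u} → (∀ v → Spec (time u) v) → Active u →
      ∃ λ μ → sent (time u) u ≡ just μ × received (time u) (parent u) ≡ just μ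
    parent-receives {u} spec on with then-sends (spec u) on refl
    ... | μ , su = μ , su , received⁺ listens (T-sym (parent-adjacent on)) su alone
      where
      listens : sent (time u) (parent u) ≡ nothing
      listens = is-nothing _ (λ eq → let (on′ , t≡ , _) = only-then (spec (parent u)) eq in
        parent-listens on on′ t≡)
      alone : ∀ {w} → T (adj (parent u) w) → w ≢ u → sent (time u) w ≡ nothing
      alone {w} pw w≢u = is-nothing _ (λ eq → let (on′ , t≡ , _) = only-then (spec w) eq in
        w≢u (time-separates on on′ (T-sym pw) t≡))

    private
      heard⇒received : ∀ {d t v c} → heard d (history t v) ≡ just c →
        ∃₂ λ s μ → t ≡ suc d + s × received s v ≡ just μ × Message.control μ ≡ c
      heard⇒received {zero} {suc t} {v} eq with received t v in r
      heard⇒received {zero} {suc t} {v} refl | just μ = t , μ , refl , r , refl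
      heard⇒received {suc d} {suc t} eq with heard⇒received {d} {t} eq
      ... | s , μ , t≡ , r , c≡ = s , μ , cong suc t≡ , r , c≡

      received⇒heard : ∀ d {s v μ} → received s v ≡ just μ →
        heard d (history (suc d + s) v) ≡ just (Message.control μ)
      received⇒heard zero    eq rewrite eq = refl
      received⇒heard (suc d) eq = received⇒heard d eq

      spec-step : ∀ t → (∀ {s} → s < t → ∀ v → Spec s v) → ∀ v → Spec t v
      spec-step t past v with active? v
      ... | no off = record
        { only-then  = λ eq → case trans (sym (cong (λ r → fires r (history t v)) (role-inactive off)))
                                         (proj₁ (proj₂ (acts eq))) of λ ()
        ; then-sends = λ on _ → ⊥-elim (off on) }
      ... | yes on with role-active on
      ...   | inj₁ (i , si≡v , role≡) = record { only-then = only ; then-sends = sending }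
        where
        fires≡ : fires (role v) (history t v) ≡
            (if does (t ≟ time v) then just (code (colour v)) else nothing)
        fires≡ rewrite role≡ | length-history t v = refl
        only : ∀ {μ} → sent t v ≡ just μ → Active v × time v ≡ t × Message.control μ ≡ code (colour v)
        only eq with acts eq
        ... | c , fc , refl with if-just⁻ (t ≟ time v) (trans (sym fires≡) fc)
        ...   | t≡ , refl = on , sym t≡ , refl
        sending : Active v → time v ≡ t → ∃ λ μ → sent t v ≡ just μ
        sending _ t≡ = _ , sends (source-awake {h = history t v} i si≡v)
            (trans fires≡ (if-yes (t ≟ time v) (sym t≡)))
      ...   | inj₂ (u , d , on-u , refl , time≡ , role≡) =
          record { only-then = only ; then-sends = sending }
        where
        trigger? : Dec (heard d (history t v) ≡ just (code (colour u)))
        trigger? = heard d (history t v) ≟ᶜ just (code (colour u))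
        fires≡ : fires (role v) (history t v) ≡ (if does trigger? then just (code (colour v)) else nothing)
        fires≡ rewrite role≡ = refl
        triggered : heard d (history t v) ≡ just (code (colour u)) → time v ≡ t
        triggered eq with heard⇒received {d} {t} {v} eq
        ... | s , μ , t≡ , r , c≡ with received⁻ r
        ...   | w , vw , sw , _ with only-then (past (subst (s <_) (sym t≡) (s≤s (m≤n+m s d))) w) sw
        ...     | on-w , time-w , c≡′ with colour-separates on-u on-w (T-sym vw)
            (code-injective (trans (sym c≡′) c≡))
        ...       | refl = trans time≡ (trans (cong (suc d +_) time-w) (sym t≡))
        only : ∀ {μ} → sent t v ≡ just μ → Active v × time v ≡ t × Message.control μ ≡ code (colour v)
        only eq with acts eq
        ... | c , fc , refl with if-just⁻ trigger? (trans (sym fires≡) fc)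
        ...   | h≡ , refl = on , triggered h≡ , refl
        sending : Active v → time v ≡ t → ∃ λ μ → sent t v ≡ just μ
        sending _ time-v = go (parent-receives (past earlier) on-u)
          where
          t≡ : t ≡ suc d + time u
          t≡ = trans (sym time-v) time≡
          earlier : time u < t
          earlier = subst (time u <_) (sym t≡) (s≤s (m≤n+m (time u) d))
          go : (∃ λ μ → sent (time u) u ≡ just μ × received (time u) (parent u) ≡ just μ) →
               ∃ λ μ → sent t v ≡ just μ
          go (μ , su , r) = _ , sends (receiver-awake (received∈history earlier r))
              (trans fires≡ (if-yes trigger? heard≡))
            where
            heard≡ : heard d (history t v) ≡ just (code (colour u))
            heard≡ = trans (cong (λ t → heard d (history t v)) t≡)
              (trans (received⇒heard d r) (cong just (proj₂ (proj₂ (only-then (past earlier u) su)))))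

    spec : ∀ t v → Spec t v
    spec = <-rec (λ t → ∀ v → Spec t v) (λ t past → spec-step t past)

    -- What an active node holds when it transmits is held by its parent afterwards.
    parent-holds : ∀ {u i t} → Active u → i ∈ held (time u) u → time u < t → i ∈ held t (parent u)
    parent-holds {u} on i∈ u<t with parent-receives (spec (time u)) on
    ... | μ , su , r with acts su
    ...   | c , _ , refl = payload⊆known (ownMessage (parent u)) (received∈history u<t r) i∈

-- Arithmetic of the transmission times

m<n+[m/n]*n : ∀ m n .{{_ : NonZero n}} → m < n + m / n * n
m<n+[m/n]*n m n = begin-strict
  m                       ≡⟨ m≡m%n+[m/n]*n m n ⟩
  m % n + m / n * n       <⟨ +-monoˡ-< (m / n * n) (m%n<n m n) ⟩
  n + m / n * n           ∎
  where open ≤-Reasoning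

digit-cancel-≤ : ∀ n {a b x y} → y < n → a * n + x ≤ b * n + y → a ≤ b
digit-cancel-≤ n {a} {b} {x} {y} y<n le = ≮⇒≥ (λ b<a → <⇒≱ (begin-strict
  b * n + y   <⟨ +-monoʳ-< (b * n) y<n ⟩
  b * n + n   ≡⟨ +-comm (b * n) n ⟩
  suc b * n   ≤⟨ *-monoˡ-≤ n b<a ⟩
  a * n       ≤⟨ m≤m+n (a * n) x ⟩
  a * n + x   ∎) le)
  where open ≤-Reasoning

digit-injective : ∀ n {a b x y} → x < n → y < n → a * n + x ≡ b * n + y → a ≡ b × x ≡ y
digit-injective n {a} {b} x<n y<n eq with ≤-antisym (digit-cancel-≤ n {a} y<n (≤-reflexive eq))
                                              (digit-cancel-≤ n {b} x<n (≤-reflexive (sym eq)))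
... | refl = refl , +-cancelˡ-≡ (a * n) _ _ eq

-- x / 6 rounded up.
sixths : ℕ → ℕ
sixths x = (x + 5) / 6

-- The distance from x to the next multiple of 6.
gap : ℕ → ℕ
gap x = 6 * sixths x ∸ x

x≤6*sixths : ∀ x → x ≤ 6 * sixths x
x≤6*sixths x = +-cancelˡ-≤ 5 _ _ (≤-pred (begin
  suc (5 + x)              ≡⟨ cong suc (+-comm 5 x) ⟩
  suc (x + 5)              ≤⟨ m<n+[m/n]*n (x + 5) 6 ⟩
  6 + sixths x * 6         ≡⟨ cong (6 +_) (*-comm (sixths x) 6) ⟩
  6 + 6 * sixths x         ∎))
  where open ≤-Reasoning

gap+x : ∀ x → gap x + x ≡ 6 * sixths x
gap+x x = m∸n+n≡m (x≤6*sixths x)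

gap≤5 : ∀ x → gap x ≤ 5
gap≤5 x = m≤n+o⇒m∸n≤o (6 * sixths x) x (≤-trans (≤-reflexive (*-comm 6 (sixths x))) (m/n*n≤m (x + 5) 6))

sixths-mono : ∀ {x y} → x ≤ y → sixths x ≤ sixths y
sixths-mono x≤y = /-monoˡ-≤ 6 (+-monoˡ-≤ 5 x≤y)

no-half : ∀ a b → 6 * a ≢ 6 * b + 3
no-half a b eq with trans (sym ([m+kn]%n≡m%n 0 a 6)) (trans (cong (_% 6) (begin
    a * 6      ≡⟨ *-comm a 6 ⟩
    6 * a      ≡⟨ eq ⟩
    6 * b + 3  ≡⟨ swap b ⟩
    3 + b * 6  ∎)) ([m+kn]%n≡m%n 3 b 6))
  where
  open ≡-Reasoning
  swap : ∀ b → 6 * b + 3 ≡ 3 + b * 6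
  swap = solve-∀
... | ()

multiples-of-3 : ∀ {a b x} → x ≤ 2 → 3 * a ≡ 3 * b + x → x ≡ 0
multiples-of-3 {a} {b} {x} x≤2 eq = begin
  x                ≡⟨ m<n⇒m%n≡m (s≤s x≤2) ⟨
  x % 3            ≡⟨ [m+kn]%n≡m%n x b 3 ⟨
  (x + b * 3) % 3  ≡⟨ cong (_% 3) (trans (swap b x) (trans (sym eq) (*-comm 3 a))) ⟩
  (0 + a * 3) % 3  ≡⟨ [m+kn]%n≡m%n 0 a 3 ⟩
  0                ∎
  where
  open ≡-Reasoning
  swap : ∀ b x → x + b * 3 ≡ 3 * b + x
  swap = solve-∀

-- The transmission time of a node in slot σ of layer d whose witness lies in
-- layer L and has rank ρ; the height of the node is L - d.  There are m slots.
module Timing (M k : ℕ) where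

  m h : ℕ
  m = suc M
  h = suc (k / m)

  -- The first slot of the window of height j; on the way from height 0 to h, in
  -- total ρ / m windows are skipped, one per step.
  window : ℕ → ℕ → ℕ
  window j ρ = m * (j + (ρ / m) ⊓ j)

  -- Times of the nodes of height less than h; early d j ρ σ + d is a multiple
  -- of 6.
  early : (d j ρ σ : ℕ) → ℕ
  early d j ρ σ = 6 * (window j ρ + σ) + gap d

  -- Times of the other nodes; then late d L ρ + d is 3 modulo 6 and does not
  -- depend on d.
  late : (d L ρ : ℕ) → ℕ
  late d L ρ = 6 * (m * h + ρ) + 3 + gap (L ∸ h) + (L ∸ d ∸ h)

  abstract
    time : (d L ρ σ : ℕ) → ℕ
    time d L ρ σ = if does (L ∸ d <? h) then early d (L ∸ d) ρ σ else late d L ρ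

    time-early : ∀ {d L ρ σ} → L ∸ d < h → time d L ρ σ ≡ early d (L ∸ d) ρ σ
    time-early {d} {L} j<h = if-yes (L ∸ d <? h) j<h

    time-late : ∀ {d L ρ σ} → ¬ L ∸ d < h → time d L ρ σ ≡ late d L ρ
    time-late {d} {L} j≮h = if-no (L ∸ d <? h) j≮h

  data Phase (d L ρ σ : ℕ) : Set where
    is-early : L ∸ d < h → time d L ρ σ ≡ early d (L ∸ d) ρ σ → Phase d L ρ σ
    is-late  : h ≤ L ∸ d → time d L ρ σ ≡ late d L ρ → Phase d L ρ σ

  phase : ∀ d L ρ σ → Phase d L ρ σ
  phase d L ρ σ with L ∸ d <? h
  ... | yes j<h = is-early j<h (time-early j<h)
  ... | no j≮h  = is-late (≮⇒≥ j≮h) (time-late j≮h)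

  k<m*h : k < m * h
  k<m*h = subst (k <_) (trans (cong (m +_) (*-comm (k / m) m)) (sym (*-suc m (k / m)))) (m<n+[m/n]*n k m)

  early+d : ∀ d j ρ σ → early d j ρ σ + d ≡ 6 * (window j ρ + σ + sixths d)
  early+d d j ρ σ = begin
    6 * (window j ρ + σ) + gap d + d      ≡⟨ +-assoc (6 * (window j ρ + σ)) (gap d) d ⟩
    6 * (window j ρ + σ) + (gap d + d)    ≡⟨ cong (6 * (window j ρ + σ) +_) (gap+x d) ⟩
    6 * (window j ρ + σ) + 6 * sixths d   ≡⟨ *-distribˡ-+ 6 (window j ρ + σ) (sixths d) ⟨
    6 * (window j ρ + σ + sixths d)       ∎
    where open ≡-Reasoning

  late+d : ∀ {d L} ρ → d ≤ L → h ≤ L ∸ d → late d L ρ + d ≡ 6 * (m * h + ρ + sixths (L ∸ h)) + 3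
  late+d {d} {L} ρ d≤L h≤j = begin
    6 * A + 3 + gap (L ∸ h) + (L ∸ d ∸ h) + d     ≡⟨ +-assoc (6 * A + 3 + gap (L ∸ h)) (L ∸ d ∸ h) d ⟩
    6 * A + 3 + gap (L ∸ h) + (L ∸ d ∸ h + d)     ≡⟨ cong (6 * A + 3 + gap (L ∸ h) +_) rest ⟩
    6 * A + 3 + gap (L ∸ h) + (L ∸ h)             ≡⟨ +-assoc (6 * A + 3) (gap (L ∸ h)) (L ∸ h) ⟩
    6 * A + 3 + (gap (L ∸ h) + (L ∸ h))           ≡⟨ cong (6 * A + 3 +_) (gap+x (L ∸ h)) ⟩
    6 * A + 3 + 6 * sixths (L ∸ h)                ≡⟨ swap A (sixths (L ∸ h)) ⟩
    6 * (A + sixths (L ∸ h)) + 3                  ∎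
    where
    open ≡-Reasoning
    A = m * h + ρ
    swap : ∀ A s → 6 * A + 3 + 6 * s ≡ 6 * (A + s) + 3
    swap = solve-∀
    rest : L ∸ d ∸ h + d ≡ L ∸ h
    rest = begin
      L ∸ d ∸ h + d    ≡⟨ cong (_+ d) (∸-+-assoc L d h) ⟩
      L ∸ (d + h) + d  ≡⟨ cong (λ x → L ∸ x + d) (+-comm d h) ⟩
      L ∸ (h + d) + d  ≡⟨ cong (_+ d) (∸-+-assoc L h d) ⟨
      L ∸ h ∸ d + d    ≡⟨ m∸n+n≡m
          (m+n≤o⇒m≤o∸n d (subst (_≤ L) (+-comm h d) (subst (h + d ≤_) (m∸n+n≡m d≤L) (+-monoˡ-≤ d h≤j)))) ⟩
      L ∸ h            ∎

  time+d : ∀ {d L} ρ σ → d ≤ L → ∃ λ q → time d L ρ σ + d ≡ 3 * q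
  time+d {d} {L} ρ σ d≤L with phase d L ρ σ
  ... | is-early _ t≡  = 2 * (window (L ∸ d) ρ + σ + sixths d) ,
        trans (cong (_+ d) t≡)
            (trans (early+d d (L ∸ d) ρ σ) (*-assoc 3 2 (window (L ∸ d) ρ + σ + sixths d)))
  ... | is-late h≤j t≡ = 2 * (m * h + ρ + sixths (L ∸ h)) + 1 ,
        trans (cong (_+ d) t≡) (trans (late+d ρ d≤L h≤j) (swap (m * h + ρ + sixths (L ∸ h))))
    where
    swap : ∀ x → 6 * x + 3 ≡ 3 * (2 * x + 1)
    swap = solve-∀

  late-mono : ∀ {L L′ ρ ρ′} → ρ ≤ ρ′ → L ≤ L′ →
    6 * (m * h + ρ + sixths (L ∸ h)) + 3 ≤ 6 * (m * h + ρ′ + sixths (L′ ∸ h)) + 3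
  late-mono ρ≤ρ′ L≤L′ = +-monoˡ-≤ 3
      (*-monoʳ-≤ 6 (+-mono-≤ (+-monoʳ-≤ (m * h) ρ≤ρ′) (sixths-mono (∸-monoˡ-≤ h L≤L′))))

  -- Nodes in one layer with distinct witnesses and distinct slots have distinct
  -- times.
  time-injective : ∀ {d L L′ ρ ρ′ σ σ′} → σ < m → σ′ < m → d ≤ L → d ≤ L′ →
    (ρ ≤ ρ′ → L ≤ L′) → (ρ′ ≤ ρ → L′ ≤ L) →
    time d L ρ σ ≡ time d L′ ρ′ σ′ → σ ≡ σ′ ⊎ ρ ≡ ρ′
  time-injective {d} {L} {L′} {ρ} {ρ′} {σ} {σ′} σ<m σ′<m d≤L d≤L′ mono mono′ eq
    with phase d L ρ σ | phase d L′ ρ′ σ′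
  ... | is-early _ t≡ | is-early _ t′≡ =
    inj₁ (proj₂ (digit-injective m {w} {w′} σ<m σ′<m (begin
      w * m + σ     ≡⟨ cong (_+ σ) (*-comm w m) ⟩
      m * w + σ     ≡⟨ *-cancelˡ-≡ (m * w + σ) (m * w′ + σ′) 6
          (+-cancelʳ-≡ (gap d) _ _ (trans (sym t≡) (trans eq t′≡))) ⟩
      m * w′ + σ′   ≡⟨ cong (_+ σ′) (*-comm m w′) ⟩
      w′ * m + σ′   ∎)))
    where
    open ≡-Reasoning
    w w′ : ℕ
    w  = L ∸ d + ρ / m ⊓ (L ∸ d)
    w′ = L′ ∸ d + ρ′ / m ⊓ (L′ ∸ d)
  ... | is-early _ t≡ | is-late h≤j′ t′≡ =
    ⊥-elim (no-half (window (L ∸ d) ρ + σ + sixths d) (m * h + ρ′ + sixths (L′ ∸ h))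
      (trans (sym (early+d d (L ∸ d) ρ σ))
      (trans (cong (_+ d) (trans (sym t≡) (trans eq t′≡))) (late+d ρ′ d≤L′ h≤j′))))
  ... | is-late h≤j t≡ | is-early _ t′≡ =
    ⊥-elim (no-half (window (L′ ∸ d) ρ′ + σ′ + sixths d) (m * h + ρ + sixths (L ∸ h))
      (trans (sym (early+d d (L′ ∸ d) ρ′ σ′))
      (trans (cong (_+ d) (trans (sym t′≡) (trans (sym eq) t≡))) (late+d ρ d≤L h≤j))))
  ... | is-late h≤j t≡ | is-late h≤j′ t′≡ = inj₂ (conclude (<-cmp ρ ρ′))
    where
    shifted : 6 * (m * h + ρ + sixths (L ∸ h)) + 3 ≡ 6 * (m * h + ρ′ + sixths (L′ ∸ h)) + 3
    shifted = trans (sym (late+d ρ d≤L h≤j))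
      (trans (cong (_+ d) (trans (sym t≡) (trans eq t′≡))) (late+d ρ′ d≤L′ h≤j′))
    strict : ∀ {L L′ ρ ρ′} → ρ < ρ′ → L ≤ L′ →
      6 * (m * h + ρ + sixths (L ∸ h)) + 3 < 6 * (m * h + ρ′ + sixths (L′ ∸ h)) + 3
    strict ρ<ρ′ L≤L′ = +-monoˡ-< 3
        (*-monoʳ-< 6 (+-mono-<-≤ (+-monoʳ-< (m * h) ρ<ρ′) (sixths-mono (∸-monoˡ-≤ h L≤L′))))
    conclude : _ → ρ ≡ ρ′
    conclude (tri< ρ<ρ′ _ _) = ⊥-elim (<⇒≢ (strict ρ<ρ′ (mono (<⇒≤ ρ<ρ′))) shifted)
    conclude (tri≈ _ ρ≡ρ′ _) = ρ≡ρ′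
    conclude (tri> _ _ ρ′<ρ) = ⊥-elim (<⇒≢ (strict ρ′<ρ (mono′ (<⇒≤ ρ′<ρ))) (sym shifted))

  early< : ∀ d j ρ {σ} → σ < m → early d j ρ σ < 6 * (window j ρ + m)
  early< d j ρ {σ} σ<m = begin-strict
    6 * (window j ρ + σ) + gap d   <⟨ +-monoʳ-< (6 * (window j ρ + σ)) (s≤s (gap≤5 d)) ⟩
    6 * (window j ρ + σ) + 6       ≡⟨ swap (window j ρ) σ ⟩
    6 * (window j ρ + suc σ)       ≤⟨ *-monoʳ-≤ 6 (+-monoʳ-≤ (window j ρ) σ<m) ⟩
    6 * (window j ρ + m)           ∎
    where
    open ≤-Reasoning
    swap : ∀ w σ → 6 * (w + σ) + 6 ≡ 6 * (w + suc σ)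
    swap = solve-∀

  window≤early : ∀ d j ρ σ → 6 * window j ρ ≤ early d j ρ σ
  window≤early d j ρ σ = ≤-trans (*-monoʳ-≤ 6 (m≤m+n (window j ρ) σ)) (m≤m+n _ (gap d))

  m*[ρ/m]≤ρ : ∀ ρ → m * (ρ / m) ≤ ρ
  m*[ρ/m]≤ρ ρ = ≤-trans (≤-reflexive (*-comm m (ρ / m))) (m/n*n≤m ρ m)

  suc-∸ : ∀ {d L} → suc d ≤ L → suc (L ∸ suc d) ≡ L ∸ d
  suc-∸ {d} {L} d<L = sym (+-∸-assoc 1 d<L)

  -- A node transmits later than its children.
  time-mono : ∀ {d L L′ ρ ρ′ σ σ′} → σ′ < m → suc d ≤ L′ → L′ ≤ L → ρ′ ≤ ρ →
    time (suc d) L′ ρ′ σ′ < time d L ρ σ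
  time-mono {d} {L} {L′} {ρ} {ρ′} {σ} {σ′} σ′<m d<L′ L′≤L ρ′≤ρ = cases (phase (suc d) L′ ρ′ σ′)
      (phase d L ρ σ)
    where
    open ≤-Reasoning
    j j′ : ℕ
    j  = L ∸ d
    j′ = L′ ∸ suc d
    j′<j : suc j′ ≤ j
    j′<j = subst (_≤ j) (sym (suc-∸ d<L′)) (∸-monoˡ-≤ d L′≤L)
    cases : Phase (suc d) L′ ρ′ σ′ → Phase d L ρ σ → time (suc d) L′ ρ′ σ′ < time d L ρ σ
    cases (is-early j′<h t′≡) (is-early _ t≡) = begin-strict
      time (suc d) L′ ρ′ σ′               ≡⟨ t′≡ ⟩
      early (suc d) j′ ρ′ σ′              <⟨ early< (suc d) j′ ρ′ σ′<m ⟩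
      6 * (window j′ ρ′ + m)
          ≡⟨ cong (6 *_) (trans (+-comm (window j′ ρ′) m) (sym (*-suc m _))) ⟩
      6 * (m * suc (j′ + (ρ′ / m) ⊓ j′))
          ≤⟨ *-monoʳ-≤ 6 (*-monoʳ-≤ m (+-mono-≤ j′<j (⊓-mono-≤ (/-monoˡ-≤ m ρ′≤ρ) (<⇒≤ j′<j)))) ⟩
      6 * window j ρ                      ≤⟨ window≤early d j ρ σ ⟩
      early d j ρ σ                       ≡⟨ t≡ ⟨
      time d L ρ σ                        ∎
    cases (is-early j′<h t′≡) (is-late _ t≡) = begin-strict
      time (suc d) L′ ρ′ σ′               ≡⟨ t′≡ ⟩
      early (suc d) j′ ρ′ σ′              <⟨ early< (suc d) j′ ρ′ σ′<m ⟩
      6 * (window j′ ρ′ + m)              ≤⟨ *-monoʳ-≤ 6 enough ⟩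
      6 * (m * h + ρ)
          ≤⟨ ≤-trans (m≤m+n _ 3) (≤-trans (m≤m+n _ (gap (L ∸ h))) (m≤m+n _ (L ∸ d ∸ h))) ⟩
      late d L ρ                          ≡⟨ t≡ ⟨
      time d L ρ σ                        ∎
      where
      swap : ∀ m j e → m * (j + e) + m ≡ m * suc j + m * e
      swap = solve-∀
      enough : window j′ ρ′ + m ≤ m * h + ρ
      enough = begin
        m * (j′ + (ρ′ / m) ⊓ j′) + m      ≤⟨ +-monoˡ-≤ m (*-monoʳ-≤ m (+-monoʳ-≤ j′ (m⊓n≤m (ρ′ / m) j′))) ⟩
        m * (j′ + ρ′ / m) + m             ≡⟨ swap m j′ (ρ′ / m) ⟩
        m * suc j′ + m * (ρ′ / m)         ≤⟨ +-mono-≤ (*-monoʳ-≤ m j′<h) (≤-trans (m*[ρ/m]≤ρ ρ′) ρ′≤ρ) ⟩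
        m * h + ρ                         ∎
    cases (is-late h≤j′ t′≡) (is-early j<h t≡) = ⊥-elim (<⇒≱ (≤-<-trans h≤j′ j′<j) (<⇒≤ j<h))
    cases (is-late h≤j′ t′≡) (is-late h≤j t≡) = +-cancelʳ-≤ d _ _ (begin
      suc (time (suc d) L′ ρ′ σ′) + d                 ≡⟨ cong (λ t → suc t + d) t′≡ ⟩
      suc (late (suc d) L′ ρ′) + d                    ≡⟨ +-suc (late (suc d) L′ ρ′) d ⟨
      late (suc d) L′ ρ′ + suc d                      ≡⟨ late+d ρ′ d<L′ h≤j′ ⟩
      6 * (m * h + ρ′ + sixths (L′ ∸ h)) + 3          ≤⟨ late-mono ρ′≤ρ L′≤L ⟩
      6 * (m * h + ρ + sixths (L ∸ h)) + 3
          ≡⟨ late+d ρ (≤-trans (n≤1+n d) (≤-trans d<L′ L′≤L)) h≤j ⟨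
      late d L ρ + d                                  ≡⟨ cong (_+ d) t≡ ⟨
      time d L ρ σ + d                                ∎)

  -- On the path of one witness, consecutive times are close.
  time-step : ∀ {d L ρ σ σ′} → σ < m → suc d ≤ L → ρ ≤ k →
    time d L ρ σ ≤ time (suc d) L ρ σ′ + 20 * m
  time-step {d} {L} {ρ} {σ} {σ′} σ<m d<L ρ≤k = cases (phase (suc d) L ρ σ′) (phase d L ρ σ)
    where
    open ≤-Reasoning
    j j′ e : ℕ
    j  = L ∸ d
    j′ = L ∸ suc d
    e  = ρ / m
    j≡ : j ≡ suc j′
    j≡ = sym (suc-∸ d<L)
    cases : Phase (suc d) L ρ σ′ → Phase d L ρ σ → time d L ρ σ ≤ time (suc d) L ρ σ′ + 20 * m
    cases (is-early _ t′≡) (is-early _ t≡) = begin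
      time d L ρ σ                        ≡⟨ t≡ ⟩
      early d j ρ σ                       ≤⟨ <⇒≤ (early< d j ρ σ<m) ⟩
      6 * (m * (j + e ⊓ j) + m)           ≡⟨ cong (λ j → 6 * (m * (j + e ⊓ j) + m)) j≡ ⟩
      6 * (m * (suc j′ + e ⊓ suc j′) + m)
          ≤⟨ *-monoʳ-≤ 6 (+-monoˡ-≤ m (*-monoʳ-≤ m (+-monoʳ-≤ (suc j′) (⊓-monoˡ-≤ (suc j′) (n≤1+n e))))) ⟩
      6 * (m * (suc j′ + suc (e ⊓ j′)) + m) ≡⟨ swap m j′ (e ⊓ j′) ⟩
      6 * window j′ ρ + 18 * m
          ≤⟨ +-mono-≤ (window≤early (suc d) j′ ρ σ′) (*-monoˡ-≤ m (m≤m+n 18 2)) ⟩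
      early (suc d) j′ ρ σ′ + 20 * m      ≡⟨ cong (_+ 20 * m) t′≡ ⟨
      time (suc d) L ρ σ′ + 20 * m        ∎
      where
      swap : ∀ m j x → 6 * (m * (suc j + suc x) + m) ≡ 6 * (m * (j + x)) + 18 * m
      swap = solve-∀
    cases (is-early j′<h t′≡) (is-late h≤j t≡) = begin
      time d L ρ σ                                        ≡⟨ t≡ ⟩
      6 * (m * h + ρ) + 3 + gap (L ∸ h) + (j ∸ h)
          ≤⟨ +-mono-≤ (+-mono-≤ (+-monoˡ-≤ 3 (*-monoʳ-≤ 6 near)) (gap≤5 (L ∸ h))) (≤-reflexive j∸h≡0) ⟩
      6 * (window j′ ρ + 2 * m) + 3 + 5 + 0               ≡⟨ swap (window j′ ρ) m ⟩
      6 * window j′ ρ + (12 * m + 8 * 1)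
          ≤⟨ +-mono-≤ (window≤early (suc d) j′ ρ σ′) (+-monoʳ-≤ (12 * m) (*-monoʳ-≤ 8 (s≤s (z≤n {M})))) ⟩
      early (suc d) j′ ρ σ′ + (12 * m + 8 * m)
          ≡⟨ cong (early (suc d) j′ ρ σ′ +_) (*-distribʳ-+ m 12 8) ⟨
      early (suc d) j′ ρ σ′ + 20 * m                      ≡⟨ cong (_+ 20 * m) t′≡ ⟨
      time (suc d) L ρ σ′ + 20 * m                        ∎
      where
      -- The child has height h - 1, and by then all windows have been skipped.
      j≡h : h ≡ j
      j≡h = ≤-antisym h≤j (subst (_≤ h) (sym j≡) j′<h)
      j∸h≡0 : j ∸ h ≡ 0
      j∸h≡0 = trans (cong (_∸ h) (sym j≡h)) (n∸n≡0 h)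
      j′≡ : k / m ≡ j′
      j′≡ = suc-injective (trans j≡h j≡)
      e≤j′ : e ≤ j′
      e≤j′ = subst (e ≤_) j′≡ (/-monoˡ-≤ m ρ≤k)
      swap : ∀ w m → 6 * (w + 2 * m) + 3 + 5 + 0 ≡ 6 * w + (12 * m + 8 * 1)
      swap = solve-∀
      swap′ : ∀ m j e → m * suc j + (m + e * m) ≡ m * (j + e) + 2 * m
      swap′ = solve-∀
      near : m * h + ρ ≤ window j′ ρ + 2 * m
      near = begin
        m * h + ρ                     ≤⟨ +-monoʳ-≤ (m * h) (<⇒≤ (m<n+[m/n]*n ρ m)) ⟩
        m * h + (m + e * m)           ≡⟨ cong (λ x → m * suc x + (m + e * m)) j′≡ ⟩
        m * suc j′ + (m + e * m)      ≡⟨ swap′ m j′ e ⟩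
        m * (j′ + e) + 2 * m          ≡⟨ cong (λ x → m * (j′ + x) + 2 * m) (m≤n⇒m⊓n≡m e≤j′) ⟨
        m * (j′ + e ⊓ j′) + 2 * m     ∎
    cases (is-late h≤j′ t′≡) (is-early j<h t≡) =
      ⊥-elim (<⇒≱ j<h (≤-trans h≤j′ (subst (j′ ≤_) (sym j≡) (n≤1+n j′))))
    cases (is-late h≤j′ t′≡) (is-late h≤j t≡) = +-cancelʳ-≤ d _ _ (begin
      time d L ρ σ + d                                ≡⟨ cong (_+ d) t≡ ⟩
      late d L ρ + d                                  ≡⟨ late+d ρ (<⇒≤ d<L) h≤j ⟩
      6 * (m * h + ρ + sixths (L ∸ h)) + 3            ≡⟨ late+d ρ d<L h≤j′ ⟨
      late (suc d) L ρ + suc d                        ≡⟨ +-assoc (late (suc d) L ρ) 1 d ⟨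
      late (suc d) L ρ + 1 + d
          ≤⟨ +-monoˡ-≤ d (+-monoʳ-≤ (late (suc d) L ρ) (s≤s (z≤n {M + 19 * m}))) ⟩
      late (suc d) L ρ + 20 * m + d                   ≡⟨ cong (λ t → t + 20 * m + d) t′≡ ⟨
      time (suc d) L ρ σ′ + 20 * m + d                ∎)

  -- A node of height 0 transmits within the first window.
  time-start : ∀ {d L ρ σ} → σ < m → L ∸ d ≡ 0 → time d L ρ σ < 6 * m
  time-start {d} {L} {ρ} {σ} σ<m j≡0 with phase d L ρ σ
  ... | is-late h≤j _ = ⊥-elim (<⇒≱ (s≤s z≤n) (≤-trans h≤j (≤-reflexive j≡0)))
  ... | is-early _ t≡ = begin-strict
    time d L ρ σ                    ≡⟨ t≡ ⟩
    early d (L ∸ d) ρ σ             ≡⟨ cong (λ j → early d j ρ σ) j≡0 ⟩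
    early d 0 ρ σ                   <⟨ early< d 0 ρ σ<m ⟩
    6 * (m * (ρ / m ⊓ 0) + m)       ≡⟨ cong (λ x → 6 * (m * x + m)) (⊓-zeroʳ (ρ / m)) ⟩
    6 * (m * 0 + m)                 ≡⟨ cong (λ x → 6 * (x + m)) (*-zeroʳ m) ⟩
    6 * m                           ∎
    where open ≤-Reasoning

  module _ {d L ρ σ D : ℕ} (σ<m : σ < m) (1≤d : 1 ≤ d) (d≤L : d ≤ L) (L≤D : L ≤ D) (ρ<k : ρ < k)
      (m≤k : m ≤ k) where

    private
      open ≤-Reasoning
      j : ℕ
      j = L ∸ d
      j<D : j < D
      j<D = ≤-trans (∸-monoʳ-< 1≤d d≤L) L≤D

      early-bound : early d j ρ σ < 12 * (m * suc j)
      early-bound = begin-strict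
        early d j ρ σ                     <⟨ early< d j ρ σ<m ⟩
        6 * (m * (j + ρ / m ⊓ j) + m)
            ≤⟨ *-monoʳ-≤ 6 (+-monoˡ-≤ m (*-monoʳ-≤ m (+-monoʳ-≤ j (m⊓n≤n (ρ / m) j)))) ⟩
        6 * (m * (j + j) + m)             ≤⟨ m≤m+n _ (6 * m) ⟩
        6 * (m * (j + j) + m) + 6 * m     ≡⟨ swap m j ⟩
        12 * (m * suc j)                  ∎
        where
        swap : ∀ m j → 6 * (m * (j + j) + m) + 6 * m ≡ 12 * (m * suc j)
        swap = solve-∀

      late-bound : late d L ρ < 6 * (m * h) + 6 * ρ + 9 + D
      late-bound = begin-strict
        6 * (m * h + ρ) + 3 + gap (L ∸ h) + (j ∸ h)
            ≤⟨ +-mono-≤ (+-monoʳ-≤ (6 * (m * h + ρ) + 3) (gap≤5 (L ∸ h))) (≤-trans (m∸n≤m j h) (<⇒≤ j<D)) ⟩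
        6 * (m * h + ρ) + 3 + 5 + D                  <⟨ n<1+n _ ⟩
        suc (6 * (m * h + ρ) + 3 + 5 + D)            ≡⟨ swap (m * h) ρ D ⟩
        6 * (m * h) + 6 * ρ + 9 + D                  ∎
        where
        swap : ∀ x ρ D → suc (6 * (x + ρ) + 3 + 5 + D) ≡ 6 * x + 6 * ρ + 9 + D
        swap = solve-∀

      m*h≤2k : m * h ≤ 2 * k
      m*h≤2k = begin
        m * suc (k / m)      ≡⟨ *-suc m (k / m) ⟩
        m + m * (k / m)      ≤⟨ +-mono-≤ m≤k (m*[ρ/m]≤ρ k) ⟩
        k + k                ≡⟨ cong (k +_) (+-identityʳ k) ⟨
        2 * k                ∎

      1≤k : 1 ≤ k
      1≤k = ≤-trans (s≤s z≤n) ρ<k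

    time<D+k : time d L ρ σ < 30 * (D + k)
    time<D+k with phase d L ρ σ
    ... | is-early j<h t≡ = begin-strict
      time d L ρ σ        ≡⟨ t≡ ⟩
      early d j ρ σ       <⟨ early-bound ⟩
      12 * (m * suc j)    ≤⟨ *-monoʳ-≤ 12 (≤-trans (*-monoʳ-≤ m j<h) m*h≤2k) ⟩
      12 * (2 * k)        ≡⟨ *-assoc 12 2 k ⟨
      24 * k              ≤⟨ *-mono-≤ (m≤m+n 24 6) (m≤n+m k D) ⟩
      30 * (D + k)        ∎
    ... | is-late h≤j t≡ = begin-strict
      time d L ρ σ                         ≡⟨ t≡ ⟩
      late d L ρ                           <⟨ late-bound ⟩
      6 * (m * h) + 6 * ρ + 9 * 1 + D
          ≤⟨ +-monoˡ-≤ D (+-mono-≤ (+-mono-≤ (*-monoʳ-≤ 6 m*h≤2k) (*-monoʳ-≤ 6 (<⇒≤ ρ<k)))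
              (*-monoʳ-≤ 9 1≤k)) ⟩
      6 * (2 * k) + 6 * k + 9 * k + D      ≤⟨ m≤m+n _ (3 * k + 29 * D) ⟩
      6 * (2 * k) + 6 * k + 9 * k + D + (3 * k + 29 * D)  ≡⟨ swap k D ⟩
      30 * (D + k)                         ∎
      where
      swap : ∀ k D → 6 * (2 * k) + 6 * k + 9 * k + D + (3 * k + 29 * D) ≡ 30 * (D + k)
      swap = solve-∀

    time<D*m : time d L ρ σ < 30 * (D * m)
    time<D*m with phase d L ρ σ
    ... | is-early j<h t≡ = begin-strict
      time d L ρ σ        ≡⟨ t≡ ⟩
      early d j ρ σ       <⟨ early-bound ⟩
      12 * (m * suc j)    ≤⟨ *-mono-≤ (m≤m+n 12 18) (*-monoʳ-≤ m j<D) ⟩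
      30 * (m * D)        ≡⟨ cong (30 *_) (*-comm m D) ⟩
      30 * (D * m)        ∎
    ... | is-late h≤j t≡ = begin-strict
      time d L ρ σ                         ≡⟨ t≡ ⟩
      late d L ρ                           <⟨ late-bound ⟩
      6 * (m * h) + 6 * ρ + 9 * 1 + D
          ≤⟨ +-mono-≤ (+-mono-≤
              (+-mono-≤ (*-monoʳ-≤ 6 mh≤) (*-monoʳ-≤ 6 (≤-trans (<⇒≤ ρ<k) (≤-trans (<⇒≤ k<m*h) mh≤))))
                  (*-monoʳ-≤ 9 1≤Dm)) (m≤m*n D m) ⟩
      6 * X + 6 * X + 9 * X + X        ≤⟨ m≤m+n _ (8 * X) ⟩
      6 * X + 6 * X + 9 * X + X + 8 * X ≡⟨ swap X ⟩
      30 * X                               ∎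
      where
      X : ℕ
      X = D * m
      mh≤ : m * h ≤ X
      mh≤ = ≤-trans (*-monoʳ-≤ m (≤-trans h≤j (<⇒≤ j<D))) (≤-reflexive (*-comm m D))
      1≤Dm : 1 ≤ X
      1≤Dm = *-mono-≤ (≤-trans (s≤s z≤n) j<D) (s≤s (z≤n {M}))
      swap : ∀ X → 6 * X + 6 * X + 9 * X + X + 8 * X ≡ 30 * X
      swap = solve-∀

-- Walks and distances

module _ {n : ℕ} {adj : Fin n → Fin n → Bool} where

  walk? : ∀ ℓ u w → Dec (Walk adj ℓ u w)
  walk? zero u w = map′ (λ { refl → nil }) (λ { nil → refl }) (u ≟ᶠ w)
  walk? (suc ℓ) u w = map′ (λ (_ , uv , vw) → cons uv vw) (λ { (cons uv vw) → _ , uv , vw })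
    (any? (λ v → T? (adj u v) ×-dec walk? ℓ v w))

-- The schedule of a network

-- The breadth-first tree, the slots, the transmission times and the labels of an
-- instance with at least one source.
module Labelling {K : ℕ} (I : Instance (suc K)) where
  open Instance I
  open NetworkProperties network

  abstract
    nearest : ∀ v → ∃ λ ℓ → Walk adj ℓ v sink × (∀ ℓ′ → Walk adj ℓ′ v sink → ℓ ≤ ℓ′)
    nearest v = least (λ ℓ → walk? ℓ v sink) (connected v sink)

    -- The distance from the sink.
    dist : Node → ℕ
    dist v = proj₁ (nearest v)

    dist-isDistance : ∀ v → IsDistance v sink (dist v)
    dist-isDistance v = proj₂ (nearest v)

  dist-step : ∀ {v w} → T (adj v w) → dist v ≤ suc (dist w)
  dist-step {v} {w} vw = proj₂ (dist-isDistance v) _ (cons vw (proj₁ (dist-isDistance w)))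

  dist>0⇒≢sink : ∀ {v} → 1 ≤ dist v → v ≢ sink
  dist>0⇒≢sink 1≤d refl = <⇒≱ 1≤d (proj₂ (dist-isDistance sink) 0 nil)

  ≢sink⇒dist>0 : ∀ {v} → v ≢ sink → 1 ≤ dist v
  ≢sink⇒dist>0 {v} v≢s with dist v | proj₁ (dist-isDistance v)
  ... | zero  | nil = ⊥-elim (v≢s refl)
  ... | suc _ | _   = s≤s z≤n

  Closer : Node → Node → Set
  Closer v w = T (adj v w) × suc (dist w) ≡ dist v

  abstract
    closer? : ∀ v w → Dec (Closer v w)
    closer? v w = T? (adj v w) ×-dec (suc (dist w) ≟ dist v)

  closer-exists : ∀ {v} → v ≢ sink → ∃ (Closer v)
  closer-exists {v} v≢s with dist v | dist-isDistance v | dist-step {v}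
  ... | zero  | nil , _            | _    = ⊥-elim (v≢s refl)
  ... | suc ℓ | cons {v = w} vw ws , _ | step =
    w , vw , ≤-antisym (s≤s (proj₂ (dist-isDistance w) ℓ ws)) (step vw)

  -- The parent of v is its first neighbour closer to the sink.
  abstract
    parent : Node → Node
    parent v = argmin (λ w → if does (closer? v w) then toℕ w else size) sink nodes

    parent-first : ∀ {v} → v ≢ sink →
      Closer v (parent v) × (∀ {w} → Closer v w → toℕ (parent v) ≤ toℕ w)
    parent-first {v} v≢s with closer-exists v≢s
    ... | w₀ , c₀ = is-closer , λ {w} c → subst (_≤ toℕ w) (weight-closer is-closer) (minimal c)
      where
      weight : Node → ℕ
      weight w = if does (closer? v w) then toℕ w else size
      weight-closer : ∀ {w} → Closer v w → weight w ≡ toℕ w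
      weight-closer {w} c = if-yes (closer? v w) c
      minimal : ∀ {w} → Closer v w → weight (parent v) ≤ toℕ w
      minimal {w} c = subst (weight (parent v) ≤_) (weight-closer c)
        (All.lookup (f[argmin]≤f[xs] {f = weight} sink nodes) (∈-allFin w))
      light⇒closer : ∀ {w} → weight w < size → Closer v w
      light⇒closer {w} light = decidable-stable (closer? v w)
        (λ not → <-irrefl (if-no (closer? v w) not) light)
      is-closer : Closer v (parent v)
      is-closer = light⇒closer (≤-<-trans (minimal c₀) (toℕ<n w₀))

  parent-adjacent : ∀ {v} → v ≢ sink → T (adj v (parent v))
  parent-adjacent v≢s = proj₁ (proj₁ (parent-first v≢s))

  dist-parent : ∀ {v} → v ≢ sink → suc (dist (parent v)) ≡ dist v
  dist-parent v≢s = proj₂ (proj₁ (parent-first v≢s))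

  ancestor : ℕ → Node → Node
  ancestor zero    v = v
  ancestor (suc j) v = parent (ancestor j v)

  dist-ancestor : ∀ j {v} → j ≤ dist v → j + dist (ancestor j v) ≡ dist v
  dist-ancestor zero    _   = refl
  dist-ancestor (suc j) {v} j<d = begin
    suc j + dist (parent u)    ≡⟨ +-suc j (dist (parent u)) ⟨
    j + suc (dist (parent u))  ≡⟨ cong (j +_) (dist-parent (dist>0⇒≢sink 1≤du)) ⟩
    j + dist u                 ≡⟨ dist-ancestor j (<⇒≤ j<d) ⟩
    dist v                     ∎
    where
    open ≡-Reasoning
    u : Node
    u = ancestor j v
    1≤du : 1 ≤ dist u
    1≤du = +-cancelˡ-≤ j _ _ (subst₂≤ (+-comm 1 j) (sym (dist-ancestor j (<⇒≤ j<d))) j<d)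
      where
      subst₂≤ : ∀ {a b c d} → a ≡ b → c ≡ d → a ≤ c → b ≤ d
      subst₂≤ refl refl le = le

  -- The distance of the i-th source from the sink.
  depth : Fin (suc K) → ℕ
  depth i = dist (source i)

  -- The rank orders the sources by depth, ties being broken by index.
  private
    key : Fin (suc K) → ℕ
    key i = depth i * suc K + toℕ i

  ρ : Fin (suc K) → ℕ
  ρ = rank key

  ρ-depth : ∀ {i j} → ρ i ≤ ρ j → depth i ≤ depth j
  ρ-depth {i} {j} le = digit-cancel-≤ (suc K) {x = toℕ i} (toℕ<n j) (rank-cancel-≤ key le)

  ρ-injective : ∀ {i j} → ρ i ≡ ρ j → i ≡ j
  ρ-injective {i} {j} eq = toℕ-injective
      (proj₂ (digit-injective (suc K) {depth i} {depth j} (toℕ<n i) (toℕ<n j)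
    (≤-antisym (rank-cancel-≤ key (≤-reflexive eq)) (rank-cancel-≤ key (≤-reflexive (sym eq))))))

  -- Below i v: the tree path from the i-th source to the sink passes v.
  Below : Fin (suc K) → Node → Set
  Below i v = ancestor (depth i ∸ dist v) (source i) ≡ v

  abstract
    below? : ∀ i v → Dec (Below i v)
    below? i v = ancestor (depth i ∸ dist v) (source i) ≟ᶠ v

  below-dist : ∀ {i v} → Below i v → dist v ≤ depth i
  below-dist {i} {v} b with ≤-total (dist v) (depth i)
  ... | inj₁ le = le
  ... | inj₂ ge with trans (sym (cong (λ j → ancestor j (source i)) (m≤n⇒m∸n≡0 ge))) b
  ...   | refl = ≤-refl

  below-parent : ∀ {i v} → v ≢ sink → Below i v → Below i (parent v)
  below-parent {i} {v} v≢s b = trans (cong (λ j → ancestor j (source i)) (begin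
    depth i ∸ dist (parent v)
        ≡⟨ +-∸-assoc 1 (subst (_≤ depth i) (sym (dist-parent v≢s)) (below-dist b)) ⟩
    suc (depth i ∸ suc (dist (parent v))) ≡⟨ cong (λ d → suc (depth i ∸ d)) (dist-parent v≢s) ⟩
    suc (depth i ∸ dist v)              ∎)) (cong parent b)
    where open ≡-Reasoning

  -- The witness of v is the source of highest rank below v; its value is
  -- irrelevant when no source is below v.
  abstract
    wit : Node → Fin (suc K)
    wit v = argmax (λ i → if does (below? i v) then suc (ρ i) else 0) zero (allFin (suc K))

    wit-highest : ∀ {i v} → Below i v → Below (wit v) v × ρ i ≤ ρ (wit v)
    wit-highest {i} {v} b = is-below , ≤-pred (subst (suc (ρ i) ≤_) (weight-below is-below) maximal)
      where
      weight : Fin (suc K) → ℕ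
      weight j = if does (below? j v) then suc (ρ j) else 0
      weight-below : ∀ {j} → Below j v → weight j ≡ suc (ρ j)
      weight-below {j} b = if-yes (below? j v) b
      maximal : suc (ρ i) ≤ weight (wit v)
      maximal = subst (_≤ weight (wit v)) (weight-below b)
        (All.lookup (f[xs]≤f[argmax] {f = weight} zero (allFin (suc K))) (∈-allFin i))
      heavy⇒below : ∀ {j} → 0 < weight j → Below j v
      heavy⇒below {j} heavy = decidable-stable (below? j v)
        (λ not → <-irrefl (sym (if-no (below? j v) not)) heavy)
      is-below : Below (wit v) v
      is-below = heavy⇒below (≤-trans (s≤s z≤n) maximal)

  -- A node other than the sink is active if a tree path from a source to the
  -- sink passes it.
  Active : Node → Set
  Active v = v ≢ sink × Below (wit v) v

  abstract
    active? : ∀ v → Dec (Active v)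
    active? v = ¬? (v ≟ᶠ sink) ×-dec below? (wit v) v

  -- The distance of an active node from its witness.
  height : Node → ℕ
  height v = depth (wit v) ∸ dist v

  -- The child of v on the path from the i-th source, which lies j + 1 layers
  -- farther from the sink than v.
  module _ {i v j} (b : Below i v) (gap≡ : depth i ∸ dist v ≡ suc j) where

    private
      u : Node
      u = ancestor j (source i)
      deep : suc j + dist v ≡ depth i
      deep = trans (cong (_+ dist v) (sym gap≡)) (m∸n+n≡m (below-dist b))
      j≤depth : suc j ≤ depth i
      j≤depth = subst (suc j ≤_) deep (m≤m+n (suc j) (dist v))

    child-parent : parent u ≡ v
    child-parent = trans (cong (λ j → ancestor j (source i)) (sym gap≡)) b

    child-dist : dist u ≡ suc (dist v)
    child-dist = +-cancelˡ-≡ j _ _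
        (trans (dist-ancestor j (<⇒≤ j≤depth)) (trans (sym deep) (sym (+-suc j (dist v)))))

    child-below : Below i u
    child-below = cong (λ j → ancestor j (source i)) (begin
      depth i ∸ dist u     ≡⟨ cong (_∸ dist u) (dist-ancestor j (<⇒≤ j≤depth)) ⟨
      j + dist u ∸ dist u  ≡⟨ m+n∸n≡m j (dist u) ⟩
      j                    ∎)
      where open ≡-Reasoning

    child-active : Active u
    child-active = dist>0⇒≢sink (subst (1 ≤_) (sym child-dist) (s≤s z≤n)) , proj₁ (wit-highest child-below)

  child-wit : ∀ {v j} (b : Below (wit v) v) → height v ≡ suc j →
    wit (ancestor j (source (wit v))) ≡ wit v
  child-wit {v} {j} b eq = ρ-injective (≤-antisym
    (proj₂ (wit-highest {wit u} {v} (subst (Below (wit u)) (child-parent b eq)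
      (below-parent (proj₁ (child-active b eq)) (proj₂ (child-active b eq))))))
    (proj₂ (wit-highest (child-below b eq))))
    where
    u : Node
    u = ancestor j (source (wit v))

  -- Slots

  private
    -- Slots are assigned in the order of the parents.
    order : Node → ℕ
    order v = toℕ (parent v) * size + toℕ v

    order-injective : ∀ {u v} → order u ≡ order v → u ≡ v
    order-injective {u} {v} eq = toℕ-injective
        (proj₂ (digit-injective size {toℕ (parent u)} {toℕ (parent v)} (toℕ<n u) (toℕ<n v) eq))

  abstract
    -- The number m = M + 1 of slots is the minimum of the maximum degree and the
    -- number of sources, unless this is 0.
    M : ℕ
    M = pred (maxDegree ⊓ suc K)

    maxDegree⊓k≤1+M : maxDegree ⊓ suc K ≤ suc M
    maxDegree⊓k≤1+M with maxDegree ⊓ suc K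
    ... | zero  = z≤n
    ... | suc _ = ≤-refl

    1+M≡maxDegree⊓k : 1 ≤ maxDegree → suc M ≡ maxDegree ⊓ suc K
    1+M≡maxDegree⊓k 1≤Δ = suc-pred (maxDegree ⊓ suc K) {{>-nonZero (⊓-glb 1≤Δ (s≤s z≤n))}}

  open Timing M (suc K) public

  -- The parent of v might miss the transmission of v because of u.
  Disturbs : Node → Node → Set
  Disturbs v u = Active v × Active u × dist u ≡ dist v × T (adj u (parent v))

  abstract
    disturbs? : ∀ v u → Dec (Disturbs v u)
    disturbs? v u = active? v ×-dec active? u ×-dec (dist u ≟ dist v) ×-dec T? (adj u (parent v))

  private
    -- The nodes that receive a slot before v and whose slots v has to avoid.
    rivals : Node → List Node
    rivals v = avoided order order-injective disturbs? v

    ∈-rivals⁻ : ∀ {u v} → u ∈ rivals v → order u < order v × Disturbs v u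
    ∈-rivals⁻ {v = v} u∈ = proj₂
        (∈-filter⁻ (λ u → (order u <? order v) ×-dec disturbs? v u) {xs = allFin size} u∈)

    length≡0 : ∀ (us : List Node) → (∀ {u} → u ∈ us → ⊥) → length us ≡ 0
    length≡0 []      _   = refl
    length≡0 (_ ∷ _) out = ⊥-elim (out (here refl))

    few-rivals : ∀ v → length (rivals v) < m
    few-rivals v = by-cases (active? v)
      where
      by-cases : Dec (Active v) → length (rivals v) < m
      by-cases (no off) = subst (_< m)
          (sym (length≡0 (rivals v) (λ u∈ → off (proj₁ (proj₂ (∈-rivals⁻ u∈)))))) (s≤s z≤n)
      by-cases (yes on) = ≤-trans (⊓-glb few-neighbours few-sources) maxDegree⊓k≤1+M
        where
        unique : Unique (v ∷ rivals v)
        unique = All.tabulate (λ u∈ v≡u → <-irrefl (cong order (sym v≡u)) (proj₁ (∈-rivals⁻ u∈)))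
               ∷ Unique.filter⁺ _ (Unique.allFin⁺ size)
        few-neighbours : suc (length (rivals v)) ≤ maxDegree
        few-neighbours = ≤-trans (unique-⊆⇒length≤ unique inside) (degree≤maxDegree (parent v))
          where
          inside : ∀ {u} → u ∈ v ∷ rivals v → u ∈ neighbours (parent v)
          inside (here refl) = ∈-neighbours⁺ (T-sym (parent-adjacent (proj₁ on)))
          inside (there u∈)  = ∈-neighbours⁺ (T-sym (proj₂ (proj₂ (proj₂ (proj₂ (∈-rivals⁻ u∈))))))
        few-sources : suc (length (rivals v)) ≤ suc K
        few-sources = ≤-trans (unique-⊆⇒length≤ unique inside)
          (≤-reflexive (trans (length-map on-layer (allFin (suc K))) (length-allFin (suc K))))
          where
          on-layer : Fin (suc K) → Node
          on-layer i = ancestor (depth i ∸ dist v) (source i)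
          inside : ∀ {u} → u ∈ v ∷ rivals v → u ∈ map on-layer (allFin (suc K))
          inside (here refl) = subst (_∈ map on-layer (allFin (suc K))) (proj₂ on)
              (∈-map⁺ on-layer (∈-allFin (wit v)))
          inside {u} (there u∈) with ∈-rivals⁻ u∈
          ... | _ , _ , (_ , b) , d≡ , _ =
            subst (_∈ map on-layer (allFin (suc K)))
              (trans (cong (λ d → ancestor (depth (wit u) ∸ d) (source (wit u))) (sym d≡)) b)
              (∈-map⁺ on-layer (∈-allFin (wit u)))

    abstract
      slotting : ∃ λ (σ : Node → ℕ) → (∀ v → σ v < m) ×
        (∀ {u v} → order u < order v → Disturbs v u → σ u ≢ σ v)
      slotting = greedy order order-injective disturbs? m few-rivals

  slot : Node → ℕ
  slot = proj₁ slotting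

  slot<m : ∀ v → slot v < m
  slot<m = proj₁ (proj₂ slotting)

  -- The slots are constructed so that the parent of u has no other active
  -- neighbour w in the layer and slot of u.  If w were to receive its slot after
  -- u, then both would have the same parent, since parents are first choices.
  slot-separates : ∀ {u w} → Active u → Active w → dist w ≡ dist u → T (adj w (parent u)) →
    slot w ≡ slot u → w ≡ u
  slot-separates {u} {w} on-u on-w d≡ w~pu s≡ with <-cmp (order w) (order u)
  ... | tri≈ _ o≡ _ = order-injective o≡
  ... | tri< w<u _ _ = ⊥-elim (proj₂ (proj₂ slotting) w<u (on-u , on-w , d≡ , w~pu) s≡)
  ... | tri> _ _ u<w = ⊥-elim (proj₂ (proj₂ slotting) u<w (on-w , on-u , sym d≡ , u~pw) (sym s≡))
    where
    pw≤pu : toℕ (parent w) ≤ toℕ (parent u)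
    pw≤pu = proj₂ (parent-first (proj₁ on-w)) (w~pu , trans (dist-parent (proj₁ on-u)) (sym d≡))
    pu≤pw : toℕ (parent u) ≤ toℕ (parent w)
    pu≤pw = digit-cancel-≤ size {x = toℕ u} (toℕ<n w) (<⇒≤ u<w)
    u~pw : T (adj u (parent w))
    u~pw = subst (λ p → T (adj u p)) (toℕ-injective (≤-antisym pu≤pw pw≤pu)) (parent-adjacent (proj₁ on-u))

  -- Transmissions

  -- The round in which an active node transmits.
  transmission : Node → ℕ
  transmission v = time (dist v) (depth (wit v)) (ρ (wit v)) (slot v)

  -- The slot together with the layer modulo 3.
  colour : Node → ℕ
  colour v = slot v * 3 + dist v % 3

  -- The role of an active node of a given height.  A node of positive height is
  -- triggered by its child on the path of its witness.
  active-role : Node → ℕ → Role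
  active-role v zero    = starter (colour v) (transmission v)
  active-role v (suc j) = let u = ancestor j (source (wit v)) in
    relay (colour u) (colour v) (transmission v ∸ suc (transmission u))

  role : Node → Role
  role v = if does (active? v) then active-role v (height v) else silent

  role-inactive : ∀ {v} → ¬ Active v → role v ≡ silent
  role-inactive {v} off = if-no (active? v) off

  active⇒role : ∀ {v} → Active v → role v ≡ active-role v (height v)
  active⇒role {v} on = if-yes (active? v) on

  parent-later : ∀ {u} → Active u → transmission u < transmission (parent u)
  parent-later {u} (u≢s , b) = subst
    (λ d → time d (depth (wit u)) (ρ (wit u)) (slot u) < transmission (parent u)) (dist-parent u≢s)
    (time-mono (slot<m u) (subst (_≤ depth (wit u)) (sym (dist-parent u≢s)) (below-dist b))
        (ρ-depth higher) higher)
    where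
    higher : ρ (wit u) ≤ ρ (wit (parent u))
    higher = proj₂ (wit-highest (below-parent u≢s b))

  parent-listens : ∀ {u} → Active u → Active (parent u) → transmission (parent u) ≢ transmission u
  parent-listens on _ eq = <-irrefl (sym eq) (parent-later on)

  role-leaf : ∀ {v} → Active v → height v ≡ 0 →
    ∃ λ i → source i ≡ v × role v ≡ starter (colour v) (transmission v)
  role-leaf {v} on eq = wit v
    , trans (cong (λ j → ancestor j (source (wit v))) (sym eq)) (proj₂ on)
    , trans (active⇒role on) (cong (active-role v) eq)

  role-inner : ∀ {v j} → Active v → height v ≡ suc j →
    ∃₂ λ u d → Active u × parent u ≡ v × transmission v ≡ suc d + transmission u
               × role v ≡ relay (colour u) (colour v) d
  role-inner {v} {j} on eq = u , transmission v ∸ suc (transmission u) , on-u , child-parent (proj₂ on) eq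
      , (begin
          transmission v                                                ≡⟨ m∸n+n≡m later ⟨
          transmission v ∸ suc (transmission u) + suc (transmission u)  ≡⟨ +-suc _ (transmission u) ⟩
          suc (transmission v ∸ suc (transmission u)) + transmission u  ∎)
      , trans (active⇒role on) (cong (active-role v) eq)
    where
    open ≡-Reasoning
    u : Node
    u = ancestor j (source (wit v))
    on-u : Active u
    on-u = child-active (proj₂ on) eq
    later : transmission u < transmission v
    later = subst (λ p → transmission u < transmission p) (child-parent (proj₂ on) eq) (parent-later on-u)

  role-active : ∀ {v} → Active v →
    (∃ λ i → source i ≡ v × role v ≡ starter (colour v) (transmission v))
    ⊎ (∃₂ λ u d → Active u × parent u ≡ v × transmission v ≡ suc d + transmission u
                  × role v ≡ relay (colour u) (colour v) d)
  role-active {v} on with height v ≟ 0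
  ... | yes h≡0 = inj₁ (role-leaf on h≡0)
  ... | no h≢0  = inj₂ (role-inner on (sym (suc-pred (height v) {{≢-nonZero h≢0}})))

  -- A node adjacent to the parent of u lies in the layer of u or in one of the
  -- two layers closer to the sink.
  layer-close : ∀ {u w} → u ≢ sink → T (adj w (parent u)) → ∃ λ x → x ≤ 2 × dist w + x ≡ dist u
  layer-close {u} {w} u≢s w~pu = dist u ∸ dist w , m≤n+o⇒m∸n≤o (dist u) (dist w) far , m+[n∸m]≡n near
    where
    near : dist w ≤ dist u
    near = ≤-trans (dist-step w~pu) (≤-reflexive (dist-parent u≢s))
    far : dist u ≤ dist w + 2
    far = begin
      dist u                     ≡⟨ dist-parent u≢s ⟨
      suc (dist (parent u))      ≤⟨ s≤s (dist-step (T-sym w~pu)) ⟩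
      2 + dist w                 ≡⟨ +-comm 2 (dist w) ⟩
      dist w + 2                 ∎
      where open ≤-Reasoning

  same-layer : ∀ {u w} a b → u ≢ sink → T (adj w (parent u)) → 3 * a + dist u ≡ 3 * b + dist w →
      dist w ≡ dist u
  same-layer {u} {w} a b u≢s w~pu eq with layer-close u≢s w~pu
  ... | x , x≤2 , w+x = trans (sym (+-identityʳ (dist w))) (trans (cong (dist w +_) (sym x≡0)) w+x)
    where
    open ≡-Reasoning
    x≡0 : x ≡ 0
    x≡0 = multiples-of-3 {b} {a} x≤2 (+-cancelʳ-≡ (dist w) _ _ (begin
      3 * b + dist w         ≡⟨ eq ⟨
      3 * a + dist u         ≡⟨ cong (3 * a +_) w+x ⟨
      3 * a + (dist w + x)   ≡⟨ cong (3 * a +_) (+-comm (dist w) x) ⟩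
      3 * a + (x + dist w)   ≡⟨ +-assoc (3 * a) x (dist w) ⟨
      3 * a + x + dist w     ∎))

  transmission-separates : ∀ {u w} → Active u → Active w → T (adj w (parent u)) →
    transmission w ≡ transmission u → w ≡ u
  transmission-separates {u} {w} on-u@(u≢s , bu) on-w@(_ , bw) w~pu t≡
    with time+d (ρ (wit u)) (slot u) (below-dist bu) | time+d (ρ (wit w)) (slot w) (below-dist bw)
  ... | q , qu | q′ , qw = [ slot-separates on-u on-w d≡ w~pu , same-wit ∘ ρ-injective ]′
      (time-injective (slot<m w) (slot<m u) (below-dist bw)
          (subst (_≤ depth (wit u)) (sym d≡) (below-dist bu))
        ρ-depth ρ-depth (trans t≡ (cong (λ d → time d (depth (wit u)) (ρ (wit u)) (slot u)) (sym d≡))))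
    where
    open ≡-Reasoning
    d≡ : dist w ≡ dist u
    d≡ = same-layer q′ q u≢s w~pu (begin
      3 * q′ + dist u                            ≡⟨ cong (_+ dist u) qw ⟨
      transmission w + dist w + dist u           ≡⟨ cong (λ t → t + dist w + dist u) t≡ ⟩
      transmission u + dist w + dist u           ≡⟨ swap (transmission u) (dist w) (dist u) ⟩
      transmission u + dist u + dist w           ≡⟨ cong (_+ dist w) qu ⟩
      3 * q + dist w                             ∎)
      where
      swap : ∀ a b c → a + b + c ≡ a + c + b
      swap = solve-∀
    same-wit : wit w ≡ wit u → w ≡ u
    same-wit i≡ = begin
      w                                                 ≡⟨ bw ⟨
      ancestor (depth (wit w) ∸ dist w) (source (wit w))
          ≡⟨ cong₂ (λ i d → ancestor (depth i ∸ d) (source i)) i≡ d≡ ⟩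
      ancestor (depth (wit u) ∸ dist u) (source (wit u)) ≡⟨ bu ⟩
      u                                                 ∎

  colour-separates : ∀ {u w} → Active u → Active w → T (adj w (parent u)) → colour w ≡ colour u → w ≡ u
  colour-separates {u} {w} on-u on-w w~pu c≡ with digit-injective 3 {slot w} {slot u} (m%n<n (dist w) 3)
      (m%n<n (dist u) 3) c≡
  ... | s≡ , r≡ = slot-separates on-u on-w (same-layer (dist w / 3) (dist u / 3) (proj₁ on-u) w~pu (begin
      3 * (dist w / 3) + dist u
          ≡⟨ cong (3 * (dist w / 3) +_) (m≡m%n+[m/n]*n (dist u) 3) ⟩
      3 * (dist w / 3) + (dist u % 3 + dist u / 3 * 3)
          ≡⟨ swap (dist w / 3) (dist u % 3) (dist u / 3) ⟩
      3 * (dist u / 3) + (dist u % 3 + dist w / 3 * 3)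
          ≡⟨ cong (λ r → 3 * (dist u / 3) + (r + dist w / 3 * 3)) r≡ ⟨
      3 * (dist u / 3) + (dist w % 3 + dist w / 3 * 3)
          ≡⟨ cong (3 * (dist u / 3) +_) (m≡m%n+[m/n]*n (dist w) 3) ⟨
      3 * (dist u / 3) + dist w                                  ∎)) w~pu s≡
    where
    open ≡-Reasoning
    swap : ∀ a r b → 3 * a + (r + b * 3) ≡ 3 * b + (r + a * 3)
    swap = solve-∀

  module Run = Scheduled I Active active? parent transmission colour role role-inactive role-active
    (parent-adjacent ∘ proj₁) parent-listens
    transmission-separates colour-separates

  open ExecutionProperties relaying I Run.label using (held; source-held)

  -- A node holds the messages of all sources below it once all its children
  -- have transmitted.
  collected : ∀ j {i v t} → depth i ∸ dist v ≡ j → Below i v →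
      (∀ {u} → Active u → parent u ≡ v → transmission u < t) →
    i ∈ held t v
  collected zero {i} {v} {t} eq b _ = subst (λ v → i ∈ held t v)
    (trans (cong (λ j → ancestor j (source i)) (sym eq)) b) (source-held {t} i)
  collected (suc j) {i} {v} {t} eq b after = subst (λ v → i ∈ held t v) (child-parent b eq)
    (Run.parent-holds on-u (collected j
        (cong pred (trans (sym (+-∸-assoc 1 (below-dist u-below)))
            (trans (cong (suc (depth i) ∸_) (child-dist b eq)) eq)))
        u-below earlier)
      (after on-u (child-parent b eq)))
    where
    u : Node
    u = ancestor j (source i)
    u-below : Below i u
    u-below = child-below b eq
    on-u : Active u
    on-u = child-active b eq
    earlier : ∀ {x} → Active x → parent x ≡ u → transmission x < transmission u
    earlier {x} on-x px≡u = subst (λ p → transmission x < transmission p) px≡u (parent-later on-x)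

  below-sink : ∀ i → Below i sink
  below-sink i = at-sink (subst (λ d → dist (ancestor (depth i ∸ d) (source i)) ≡ 0) (sym dist-sink) bottom)
    where
    dist-sink : dist sink ≡ 0
    dist-sink = n≤0⇒n≡0 (proj₂ (dist-isDistance sink) 0 nil)
    bottom : dist (ancestor (depth i) (source i)) ≡ 0
    bottom = +-cancelˡ-≡ (depth i) _ _
        (trans (dist-ancestor (depth i) ≤-refl) (sym (+-identityʳ (depth i))))
    at-sink : ∀ {v} → dist v ≡ 0 → v ≡ sink
    at-sink {v} d≡0 with v ≟ᶠ sink
    ... | yes v≡s = v≡s
    ... | no v≢s  = ⊥-elim (<⇒≱ (≢sink⇒dist>0 v≢s) (≤-reflexive d≡0))

  module _ (1≤Δ : 1 ≤ maxDegree) where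

    m≤Δ : m ≤ maxDegree
    m≤Δ = ≤-trans (≤-reflexive (1+M≡maxDegree⊓k 1≤Δ)) (m⊓n≤m maxDegree (suc K))

    m≤k : m ≤ suc K
    m≤k = ≤-trans (≤-reflexive (1+M≡maxDegree⊓k 1≤Δ)) (m⊓n≤n maxDegree (suc K))

    gathers : ∀ {D} → IsDiameter D → GathersWithin relaying I Run.label
        (34 * ((D + suc K) ⊓ (D * maxDegree)))
    gathers {D} (far , _) i = collected _ refl (below-sink i) (λ {u} on _ → soon on)
      where
      dist≤D : ∀ v → dist v ≤ D
      dist≤D v = far v sink (dist v) (dist-isDistance v)
      soon : ∀ {u} → Active u → transmission u < 34 * ((D + suc K) ⊓ (D * maxDegree))
      soon {u} (u≢s , b) = <-≤-trans
          (subst (transmission u <_) (sym (*-distribˡ-⊓ 30 (D + suc K) (D * maxDegree)))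
        (⊓-glb (time<D+k (slot<m u) (≢sink⇒dist>0 u≢s) (below-dist b) (dist≤D _) (rank<n key (wit u)) m≤k)
               (<-≤-trans (time<D*m (slot<m u) (≢sink⇒dist>0 u≢s) (below-dist b) (dist≤D _)
                   (rank<n key (wit u)) m≤k)
                          (*-monoʳ-≤ 30 (*-monoʳ-≤ D m≤Δ)))))
        (*-monoˡ-≤ ((D + suc K) ⊓ (D * maxDegree)) (m≤m+n 30 4))

    colour<3m : ∀ v → colour v < 3 * m
    colour<3m v = begin-strict
      slot v * 3 + dist v % 3   <⟨ +-monoʳ-< (slot v * 3) (m%n<n (dist v) 3) ⟩
      slot v * 3 + 3            ≡⟨ +-comm (slot v * 3) 3 ⟩
      suc (slot v) * 3          ≤⟨ *-monoˡ-≤ 3 (slot<m v) ⟩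
      m * 3                     ≡⟨ *-comm m 3 ⟩
      3 * m                     ∎
      where open ≤-Reasoning

    private
      B : ℕ
      B = ⌊log₂ maxDegree ⌋ ⊓ ⌊log₂ suc K ⌋

      log-m : ⌊log₂ m ⌋ ≤ B
      log-m = ⊓-glb (⌊log₂⌋-mono-≤ m≤Δ) (⌊log₂⌋-mono-≤ m≤k)

      log-32m : ⌊log₂ 32 * m ⌋ ≤ 5 + B
      log-32m = begin
        ⌊log₂ 32 * m ⌋                           ≡⟨ cong ⌊log₂_⌋ (swap m) ⟩
        ⌊log₂ 2 * (2 * (2 * (2 * (2 * m)))) ⌋    ≡⟨ ⌊log₂[2*b]⌋≡1+⌊log₂b⌋ (2 * (2 * (2 * (2 * m)))) ⟩
        1 + ⌊log₂ 2 * (2 * (2 * (2 * m))) ⌋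
            ≡⟨ cong (1 +_) (⌊log₂[2*b]⌋≡1+⌊log₂b⌋ (2 * (2 * (2 * m)))) ⟩
        2 + ⌊log₂ 2 * (2 * (2 * m)) ⌋            ≡⟨ cong (2 +_) (⌊log₂[2*b]⌋≡1+⌊log₂b⌋ (2 * (2 * m))) ⟩
        3 + ⌊log₂ 2 * (2 * m) ⌋                  ≡⟨ cong (3 +_) (⌊log₂[2*b]⌋≡1+⌊log₂b⌋ (2 * m)) ⟩
        4 + ⌊log₂ 2 * m ⌋                        ≡⟨ cong (4 +_) (⌊log₂[2*b]⌋≡1+⌊log₂b⌋ m) ⟩
        5 + ⌊log₂ m ⌋                            ≤⟨ +-monoʳ-≤ 5 log-m ⟩
        5 + B                                    ∎
        where
        open ≤-Reasoning
        swap : ∀ m → 32 * m ≡ 2 * (2 * (2 * (2 * (2 * m))))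
        swap = solve-∀

      length-code-small : ∀ {n} → n < 32 * m → length (code n) ≤ 11 + 2 * B
      length-code-small {n} n<32m = begin
        length (code n)            ≤⟨ length-code n ⟩
        1 + 2 * ⌊log₂ suc n ⌋      ≤⟨ s≤s (*-monoʳ-≤ 2 (≤-trans (⌊log₂⌋-mono-≤ n<32m) log-32m)) ⟩
        1 + 2 * (5 + B)            ≡⟨ swap B ⟩
        11 + 2 * B                 ∎
        where
        open ≤-Reasoning
        swap : ∀ B → 1 + 2 * (5 + B) ≡ 11 + 2 * B
        swap = solve-∀

      length-colour : ∀ v → length (code (colour v)) ≤ 11 + 2 * B
      length-colour v = length-code-small (<-≤-trans (colour<3m v) (*-monoˡ-≤ m (m≤m+n 3 29)))

    role-short : ∀ {v} → Active v → length (toLabel (active-role v (height v))) ≤ 34 * (1 + B)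
    role-short {v} (v≢s , b) = by-height (height v) refl
      where
      open ≤-Reasoning
      by-height : ∀ j → height v ≡ j → length (toLabel (active-role v j)) ≤ 34 * (1 + B)
      by-height zero eq = begin
        suc (length (code (colour v) ++ code (transmission v)))
          ≡⟨ cong suc (length-++ (code (colour v))) ⟩
        suc (length (code (colour v)) + length (code (transmission v)))
          ≤⟨ s≤s (+-mono-≤ (length-colour v)
              (length-code-small (<-≤-trans (time-start (slot<m v) eq) (*-monoˡ-≤ m (m≤m+n 6 26))))) ⟩
        suc (11 + 2 * B + (11 + 2 * B))
          ≤⟨ m≤m+n _ (11 + 30 * B) ⟩
        suc (11 + 2 * B + (11 + 2 * B)) + (11 + 30 * B)
          ≡⟨ swap B ⟩
        34 * (1 + B) ∎
        where
        swap : ∀ B → suc (11 + 2 * B + (11 + 2 * B)) + (11 + 30 * B) ≡ 34 * (1 + B)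
        swap = solve-∀
      by-height (suc j) eq = begin
        suc (length (code (colour u) ++ code (colour v) ++ code δ))
          ≡⟨ cong suc (trans (length-++ (code (colour u)))
              (cong (length (code (colour u)) +_) (length-++ (code (colour v))))) ⟩
        suc (length (code (colour u)) + (length (code (colour v)) + length (code δ)))
          ≤⟨ s≤s (+-mono-≤ (length-colour u) (+-mono-≤ (length-colour v) (length-code-small δ<32m))) ⟩
        suc (11 + 2 * B + (11 + 2 * B + (11 + 2 * B)))
          ≤⟨ m≤m+n _ (28 * B) ⟩
        suc (11 + 2 * B + (11 + 2 * B + (11 + 2 * B))) + 28 * B
          ≡⟨ swap B ⟩
        34 * (1 + B) ∎
        where
        swap : ∀ B → suc (11 + 2 * B + (11 + 2 * B + (11 + 2 * B))) + 28 * B ≡ 34 * (1 + B)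
        swap = solve-∀
        u : Node
        u = ancestor j (source (wit v))
        δ : ℕ
        δ = transmission v ∸ suc (transmission u)
        close : transmission v ≤ transmission u + 20 * m
        close = subst (λ t → transmission v ≤ t + 20 * m)
          (cong₂ (λ d i → time d (depth i) (ρ i) (slot u)) (sym (child-dist b eq)) (sym (child-wit b eq)))
          (time-step (slot<m v)
              (subst (_≤ depth (wit v)) (child-dist b eq) (below-dist (child-below b eq)))
                  (<⇒≤ (rank<n key (wit v))))
        δ<32m : δ < 32 * m
        δ<32m = ≤-<-trans (≤-trans (∸-monoʳ-≤ (transmission v) (n≤1+n (transmission u)))
            (m≤n+o⇒m∸n≤o (transmission v) (transmission u) close))
                  (*-monoˡ-< m (s≤s (m≤m+n 20 11)))

    label-short : ∀ v → length (Run.label v) ≤ 34 * (1 + B)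
    label-short v = by-cases (active? v)
      where
      by-cases : Dec (Active v) → length (toLabel (role v)) ≤ 34 * (1 + B)
      by-cases (yes on) = subst (λ r → length (toLabel r) ≤ 34 * (1 + B)) (sym (active⇒role on))
          (role-short on)
      by-cases (no off) = subst (λ r → length (toLabel r) ≤ 34 * (1 + B)) (sym (role-inactive off)) z≤n

-- Opacity of source messages

T-does⁺ : ∀ {P : Set} (P? : Dec P) → P → T (does P?)
T-does⁺ P? p = subst T (sym (dec-true P? p)) tt

T-does⁻ : ∀ {P : Set} (P? : Dec P) → T (does P?) → P
T-does⁻ (yes p) _ = p

does-cong : ∀ {P Q : Set} (P? : Dec P) (Q? : Dec Q) → (P → Q) → (Q → P) → does P? ≡ does Q?
does-cong (yes p) Q? f _ = sym (dec-true Q? (f p))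
does-cong (no ¬p) Q? _ g = sym (dec-false Q? (¬p ∘ g))

mapHistory-cong : ∀ {M N : Set} {f g : M → N} (h : History M) →
  (∀ {x} → x ∈ concatMap Message.payload (catMaybes h) → f x ≡ g x) → mapHistory f h ≡ mapHistory g h
mapHistory-cong []            _  = refl
mapHistory-cong (nothing ∷ h) eq = cong (nothing ∷_) (mapHistory-cong h eq)
mapHistory-cong (just m ∷ h)  eq = cong₂ _∷_
  (cong (λ p → just (message (Message.control m) p)) (List.map-cong-local (All.tabulate (eq ∘ ∈-++⁺ˡ))))
  (mapHistory-cong h (eq ∘ ∈-++⁺ʳ (Message.payload m)))

map-≡⇒≡ : ∀ {A B : Set} {f g : A → B} {xs : List A} → map f xs ≡ map g xs → ∀ {x} → x ∈ xs → f x ≡ g x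
map-≡⇒≡ eq (here refl) = List.∷-injectiveˡ eq
map-≡⇒≡ eq (there x∈)  = map-≡⇒≡ (List.∷-injectiveʳ eq) x∈

module Opacity (alg : Algorithm) where
  open Algorithm alg

  -- A node only sends source messages that it holds: otherwise it would send
  -- the same combination if this message were replaced by another one.
  sent⊆known : ∀ {k} {label own} {h : History (Fin k)} {μ} → act label own h ≡ just μ →
    ∀ {x} → x ∈ Message.payload μ → x ∈ known own h
  sent⊆known {k} {label} {own} {h} {μ} eq {x} x∈ = decidable-stable (x ∈? known own h) (λ x∉ →
    true≢false (trans (sym (dec-true (x ≟ᶠ x) refl)) (map-≡⇒≡ (same-image x∉) x∈)))
    where
    open import Data.List.Membership.DecPropositional _≟ᶠ_ using (_∈?_)
    is-x never : Fin k → Bool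
    is-x y = does (y ≟ᶠ x)
    never _ = false
    true≢false : true ≢ false
    true≢false ()
    same-own : ∀ own → (∀ {y} → y ∈ fromMaybe own → is-x y ≡ never y) →
        Maybe.map is-x own ≡ Maybe.map never own
    same-own nothing  _  = refl
    same-own (just y) eq = cong just (eq (here refl))
    same-image : x ∉ known own h → map is-x (Message.payload μ) ≡ map never (Message.payload μ)
    same-image x∉ = cong Message.payload (Maybe.just-injective (begin
      Maybe.map (mapMessage is-x) (just μ)                    ≡⟨ cong (Maybe.map (mapMessage is-x)) eq ⟨
      Maybe.map (mapMessage is-x) (act label own h)           ≡⟨ opaque-messages is-x label own h ⟨
      act label (Maybe.map is-x own) (mapHistory is-x h)
          ≡⟨ cong₂ (act label) (same-own own (differs ∘ ∈-++⁺ˡ))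
                                                                     (mapHistory-cong h (differs ∘ ∈-++⁺ʳ
                                                                         (fromMaybe own))) ⟩
      act label (Maybe.map never own) (mapHistory never h)    ≡⟨ opaque-messages never label own h ⟩
      Maybe.map (mapMessage never) (act label own h)          ≡⟨ cong (Maybe.map (mapMessage never)) eq ⟩
      Maybe.map (mapMessage never) (just μ)                   ∎))
      where
      open ≡-Reasoning
      differs : ∀ {y} → y ∈ known own h → is-x y ≡ never y
      differs {y} y∈ = dec-false (y ≟ᶠ x) (λ { refl → x∉ y∈ })

  -- Whether a source transmits does not depend on its message.
  is-just-act : ∀ {k} label (a b : Fin k) h →
    is-just (act label (just a) h) ≡ is-just (act label (just b) h)
  is-just-act label a b h = trans (erased a) (sym (erased b))
    where
    is-just-map : ∀ {A B : Set} (f : A → B) m → is-just (Maybe.map f m) ≡ is-just m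
    is-just-map f nothing  = refl
    is-just-map f (just _) = refl
    erased : ∀ x → is-just (act label (just x) h) ≡ is-just (act label (just tt) (mapHistory (const tt) h))
    erased x = trans (sym (is-just-map (mapMessage (const tt)) _))
      (cong is-just (sym (opaque-messages (const tt) label (just x) h)))

same-is-just : ∀ {A : Set} {x y : Maybe A} → is-just x ≡ is-just y →
  (x ≡ nothing × y ≡ nothing) ⊎ (∃₂ λ a b → x ≡ just a × y ≡ just b)
same-is-just {x = nothing} {nothing} _ = inj₁ (refl , refl)
same-is-just {x = just a}  {just b}  _ = inj₂ (a , b , refl , refl)

module Indistinguishable (alg : Algorithm) {k : ℕ} (I : Instance k) (label : Instance.Node I → Label) where
  open Instance I
  open Algorithm alg
  open Opacity alg
  open ExecutionProperties alg I label

  sent-source : ∀ t a → sent t (source a) ≡ act (label (source a)) (just a) (history t (source a))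
  sent-source t a = trans (awake-sent {t} (source-awake {h = history t (source a)} a refl))
    (cong (λ own → act (label (source a)) own (history t (source a))) (own-source a))

  received-nothing : ∀ {t v μ} → sent t v ≡ just μ → received t v ≡ nothing
  received-nothing {t} {v} eq with sent t v
  ... | just _ = refl

  held-known : ∀ {t x i} → i ∈ held (suc t) x →
    i ∈ held t x ⊎ (∃ λ μ → received t x ≡ just μ × i ∈ Message.payload μ)
  held-known {t} {x} i∈ with ∈-++⁻ (fromMaybe (ownMessage x)) i∈
  ... | inj₁ i∈own = inj₁ (∈-++⁺ˡ i∈own)
  ... | inj₂ i∈rec with received t x
  ...   | nothing = inj₁ (∈-++⁺ʳ (fromMaybe (ownMessage x)) i∈rec)
  ...   | just μ with ∈-++⁻ (Message.payload μ) i∈rec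
  ...     | inj₁ i∈μ = inj₂ (μ , refl , i∈μ)
  ...     | inj₂ i∈h = inj₁ (∈-++⁺ʳ (fromMaybe (ownMessage x)) i∈h)

  held-initially : ∀ {x i} → i ∈ held 0 x → source i ≡ x
  held-initially {x} i∈ with ownMessage x in own
  held-initially (here refl) | just i = own⁻ own

  -- If two sources have the same neighbours and the same label, then they
  -- always act alike, and their messages collide wherever they arrive.
  module _ {a b : Fin k} (a≢b : a ≢ b) (twins : ∀ x → adj (source a) x ≡ adj (source b) x)
           (same-label : label (source a) ≡ label (source b)) where

    private
      u v : Node
      u = source a
      v = source b

      same-sending : ∀ t → history t u ≡ history t v → is-just (sent t u) ≡ is-just (sent t v)
      same-sending t eq = begin
        is-just (sent t u)                              ≡⟨ cong is-just (sent-source t a) ⟩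
        is-just (act (label u) (just a) (history t u))  ≡⟨ is-just-act (label u) a b (history t u) ⟩
        is-just (act (label u) (just b) (history t u))
            ≡⟨ cong₂ (λ l h → is-just (act l (just b) h)) same-label eq ⟩
        is-just (act (label v) (just b) (history t v))  ≡⟨ cong is-just (sent-source t b) ⟨
        is-just (sent t v)                              ∎
        where open ≡-Reasoning

      same-neighbours : neighbours u ≡ neighbours v
      same-neighbours = same nodes
        where
        same : ∀ xs → filterᵇ (adj u) xs ≡ filterᵇ (adj v) xs
        same []       = refl
        same (x ∷ xs) rewrite twins x with adj v x
        ... | true  = cong (x ∷_) (same xs)
        ... | false = same xs

      hear-silent : ∀ t x → sent t x ≡ nothing → received t x ≡ reception (mapMaybe (sent t) (neighbours x))
      hear-silent t x eq with sent t x
      ... | nothing = refl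

      same-history : ∀ t → history t u ≡ history t v
      same-history zero    = refl
      same-history (suc t) = cong₂ _∷_ same-reception (same-history t)
        where
        same-reception : received t u ≡ received t v
        same-reception with same-is-just (same-sending t (same-history t))
        ... | inj₁ (su , sv) = trans (hear-silent t u su)
          (trans (cong (λ xs → reception (mapMaybe (sent t) xs)) same-neighbours)
              (sym (hear-silent t v sv)))
        ... | inj₂ (_ , _ , su , sv) = trans (received-nothing su) (sym (received-nothing sv))

    twin-message-stays : ∀ t {x} → a ∈ held t x → source a ≡ x
    twin-message-stays zero    a∈ = held-initially a∈
    twin-message-stays (suc t) {x} a∈ with held-known {t} a∈
    ... | inj₁ a∈ₜ = twin-message-stays t a∈ₜ
    ... | inj₂ (μ , r , a∈μ) with received⁻ r
    ...   | y , xy , sy , alone with twin-message-stays t (sent⊆known (sent⇒act sy) a∈μ)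
    ...     | refl with same-is-just (same-sending t (same-history t))
    ...       | inj₁ (su , _) = case trans (sym su) sy of λ ()
    ...       | inj₂ (_ , _ , _ , sv) = case trans (sym sv) (alone xv v≢u) of λ ()
      where
      xv : T (adj x v)
      xv = subst T (trans (adj-sym x u) (trans (twins x) (adj-sym v x))) xy
      v≢u : v ≢ u
      v≢u eq = a≢b (source-injective (sym eq))

  -- If all nodes are sources and have the same label, then in every round
  -- either all nodes transmit or none does, and nothing is ever received.
  module _ (all-sources : ∀ x → ∃ λ i → source i ≡ x) (same-labels : ∀ x y → label x ≡ label y) where

    private
      same-sending : ∀ t → (∀ x y → history t x ≡ history t y) →
        ∀ x y → is-just (sent t x) ≡ is-just (sent t y)
      same-sending t eq x y with all-sources x | all-sources y
      ... | a , refl | b , refl = begin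
        is-just (sent t x)                              ≡⟨ cong is-just (sent-source t a) ⟩
        is-just (act (label x) (just a) (history t x))  ≡⟨ is-just-act (label x) a b (history t x) ⟩
        is-just (act (label x) (just b) (history t x))
            ≡⟨ cong₂ (λ l h → is-just (act l (just b) h)) (same-labels x y) (eq x y) ⟩
        is-just (act (label y) (just b) (history t y))  ≡⟨ cong is-just (sent-source t b) ⟨
        is-just (sent t y)                              ∎
        where open ≡-Reasoning

      deaf : ∀ t → (∀ x y → is-just (sent t x) ≡ is-just (sent t y)) → ∀ x → received t x ≡ nothing
      deaf t same x with received t x in r
      ... | nothing = refl
      ... | just μ with received⁻ r
      ...   | y , _ , sy , _ with same-is-just (same x y)
      ...     | inj₁ (_ , sy′) = case trans (sym sy) sy′ of λ ()
      ...     | inj₂ (_ , _ , sx , _) = case trans (sym r) (received-nothing sx) of λ ()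

      same-history : ∀ t x y → history t x ≡ history t y
      same-history zero    x y = refl
      same-history (suc t) x y = cong₂ _∷_ (trans (quiet x) (sym (quiet y))) (same-history t x y)
        where quiet = deaf t (same-sending t (same-history t))

    uniform-message-stays : ∀ t {x i} → i ∈ held t x → source i ≡ x
    uniform-message-stays zero    i∈ = held-initially i∈
    uniform-message-stays (suc t) {x} i∈ with held-known {t} i∈
    ... | inj₁ i∈ₜ = uniform-message-stays t i∈ₜ
    ... | inj₂ (μ , r , _) = case trans (sym r) (deaf t (same-sending t (same-history t)) x) of λ ()

-- Counting labels

-- Labels as bijective binary numerals.
numeral : Label → ℕᵇ
numeral []           = ℕᵇ.zero
numeral (true ∷ bs)  = 2[1+ numeral bs ]
numeral (false ∷ bs) = 1+[2 numeral bs ]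

numeral-injective : ∀ {xs ys} → numeral xs ≡ numeral ys → xs ≡ ys
numeral-injective {[]}         {[]}         _  = refl
numeral-injective {true ∷ xs}  {true ∷ ys}  eq = cong (true ∷_) (numeral-injective (ℕᵇ.2[1+_]-injective eq))
numeral-injective {false ∷ xs} {false ∷ ys} eq = cong (false ∷_)
    (numeral-injective (ℕᵇ.1+[2_]-injective eq))
numeral-injective {[]}         {true ∷ _}   ()
numeral-injective {[]}         {false ∷ _}  ()
numeral-injective {true ∷ _}   {[]}         ()
numeral-injective {false ∷ _}  {[]}         ()
numeral-injective {true ∷ _}   {false ∷ _}  ()
numeral-injective {false ∷ _}  {true ∷ _}   ()

numeral-bound : ∀ xs → 2 + ℕᵇ.toℕ (numeral xs) ≤ 2 ^ suc (length xs)
numeral-bound []           = ≤-refl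
numeral-bound (true ∷ xs)  = ≤-trans (≤-reflexive (swap (ℕᵇ.toℕ (numeral xs))))
    (*-monoʳ-≤ 2 (numeral-bound xs))
  where
  swap : ∀ x → 2 + 2 * suc x ≡ 2 * (2 + x)
  swap = solve-∀
numeral-bound (false ∷ xs) = ≤-trans (n≤1+n _)
  (≤-trans (≤-reflexive (swap (ℕᵇ.toℕ (numeral xs)))) (*-monoʳ-≤ 2 (numeral-bound xs)))
  where
  swap : ∀ x → 1 + (2 + suc (2 * x)) ≡ 2 * (2 + x)
  swap = solve-∀

-- There are fewer than 2 ^ (L + 1) labels of length at most L.
distinct-labels : ∀ {q} L (f : Fin q → Label) → (∀ {i j} → f i ≡ f j → i ≡ j) →
  (∀ i → length (f i) ≤ L) → q < 2 ^ suc L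
distinct-labels {q} L f f-injective short = begin-strict
  q
      ≡⟨ trans (sym (length-allFin q)) (sym (length-map number (allFin q))) ⟩
  length (map number (allFin q))
      ≤⟨ unique-⊆⇒length≤ (Unique.map⁺ (f-injective ∘ numeral-injective ∘ ℕᵇ.toℕ-injective)
          (Unique.allFin⁺ q)) inside ⟩
  length (upTo (pred (2 ^ suc L)))        ≡⟨ List.length-upTo _ ⟩
  pred (2 ^ suc L)                        <⟨ pred<2^ ⟩
  2 ^ suc L                               ∎
  where
  open ≤-Reasoning
  number : Fin q → ℕ
  number i = ℕᵇ.toℕ (numeral (f i))
  pred<2^ : pred (2 ^ suc L) < 2 ^ suc L
  pred<2^ = ≤-reflexive (suc-pred (2 ^ suc L) {{m^n≢0 2 (suc L)}})
  inside : ∀ {x} → x ∈ map number (allFin q) → x ∈ upTo (pred (2 ^ suc L))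
  inside x∈ with ∈-map⁻ number x∈
  ... | i , _ , refl = ∈-upTo⁺ (pred-mono-≤ (≤-trans (numeral-bound (f i)) (^-monoʳ-≤ 2 (s≤s (short i)))))

label≤schemeLength : ∀ (scheme : LabelingScheme) {k} (I : Instance k) v → length
    (scheme I v) ≤ schemeLength scheme I
label≤schemeLength scheme I v = All.lookup (xs≤max 0 (map (length ∘ scheme I) (Instance.nodes I)))
  (∈-map⁺ (length ∘ scheme I) (∈-allFin v))

-- Brooms

walk-++ : ∀ {n} {adj : Fin n → Fin n → Bool} {ℓ ℓ′ u v w} → Walk adj ℓ u v → Walk adj ℓ′ v w →
    ∃ λ ℓ″ → Walk adj ℓ″ u w
walk-++ nil         ws = _ , ws
walk-++ (cons a vs) ws = _ , cons a (proj₂ (walk-++ vs ws))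

walk-reverse : ∀ {n} {adj : Fin n → Fin n → Bool} (adj-sym : ∀ u v → adj u v ≡ adj v u) {ℓ u v} →
  Walk adj ℓ u v → ∃ λ ℓ′ → Walk adj ℓ′ v u
walk-reverse adj-sym nil = _ , nil
walk-reverse adj-sym (cons {u = u} {v} a vs) =
  walk-++ (proj₂ (walk-reverse adj-sym vs)) (cons (subst T (adj-sym u v) a) nil)

-- The broom on the nodes 0, …, N - 1: node 0 has the neighbours 1, …, Δ, and
-- Δ, Δ + 1, …, N - 1 is a path.  It is a tree with root 0.
module Broom (Δ N : ℕ) (2≤Δ : 2 ≤ Δ) (Δ<N : Δ < N) where

  -- The parent of node b in the tree; the value at 0 is irrelevant.
  up : ℕ → ℕ
  up b = if does (b ≤? Δ) then 0 else pred b

  up-small : ∀ {b} → b ≤ Δ → up b ≡ 0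
  up-small {b} b≤Δ = if-yes (b ≤? Δ) b≤Δ

  up-large : ∀ {b} → ¬ b ≤ Δ → up b ≡ pred b
  up-large {b} b≰Δ = if-no (b ≤? Δ) b≰Δ

  up< : ∀ {b} → 0 < b → up b < b
  up< {b} 0<b with b ≤? Δ
  ... | yes b≤Δ = subst (_< b) (sym (up-small b≤Δ)) 0<b
  ... | no b≰Δ  = subst (_< b) (sym (up-large b≰Δ)) (≤-reflexive (suc-pred b {{>-nonZero 0<b}}))

  Edge : ℕ → ℕ → Set
  Edge a b = 0 < b × up b ≡ a

  edge? : ∀ a b → Dec (Edge a b)
  edge? a b = (0 <? b) ×-dec (up b ≟ a)

  Adjacent : Fin N → Fin N → Set
  Adjacent u v = Edge (toℕ u) (toℕ v) ⊎ Edge (toℕ v) (toℕ u)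

  adjacent? : ∀ u v → Dec (Adjacent u v)
  adjacent? u v = edge? (toℕ u) (toℕ v) ⊎-dec edge? (toℕ v) (toℕ u)

  joined : Fin N → Fin N → Bool
  joined u v = does (adjacent? u v)

  joined-sym : ∀ u v → joined u v ≡ joined v u
  joined-sym u v = Bool.∨-comm (does (edge? (toℕ u) (toℕ v))) _

  joined-irrefl : ∀ v → joined v v ≡ false
  joined-irrefl v = dec-false (adjacent? v v) [ no-loop , no-loop ]′
    where
    no-loop : ¬ Edge (toℕ v) (toℕ v)
    no-loop (0<b , eq) = <-irrefl eq (up< 0<b)

  centre : Fin N
  centre = fromℕ< (≤-trans (s≤s z≤n) Δ<N)

  toℕ-centre : toℕ centre ≡ 0
  toℕ-centre = toℕ-fromℕ< _

  walk-to-centre : ∀ n (v : Fin N) → toℕ v ≤ n → ∃ λ ℓ → Walk joined ℓ v centre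
  walk-to-centre n v v≤n with toℕ v ≟ 0
  ... | yes v≡0 = 0 , subst (Walk joined 0 v) (toℕ-injective (trans v≡0 (sym toℕ-centre))) nil
  walk-to-centre zero    v v≤n | no v≢0 = ⊥-elim (v≢0 (n≤0⇒n≡0 v≤n))
  walk-to-centre (suc n) v v≤n | no v≢0 =
    _ , cons (T-does⁺ (adjacent? v u) (inj₂ (0<v , sym toℕ-u))) (proj₂ (walk-to-centre n u u≤n))
    where
    0<v : 0 < toℕ v
    0<v = n≢0⇒n>0 v≢0
    u : Fin N
    u = fromℕ< (<-trans (up< 0<v) (toℕ<n v))
    toℕ-u : toℕ u ≡ up (toℕ v)
    toℕ-u = toℕ-fromℕ< _
    u≤n : toℕ u ≤ n
    u≤n = ≤-pred (≤-trans (subst (_< toℕ v) (sym toℕ-u) (up< 0<v)) v≤n)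

  broom : Network
  broom = record
    { size       = N
    ; adj        = joined
    ; adj-sym    = joined-sym
    ; adj-irrefl = joined-irrefl
    ; connected  = λ u v → walk-++ (proj₂ (walk-to-centre _ u ≤-refl))
                     (proj₂ (walk-reverse joined-sym (proj₂ (walk-to-centre _ v ≤-refl))))
    }

  open NetworkProperties broom
  open Network broom using (neighbours; degree; maxDegree)

  up≡0⇒small : ∀ {b} → up b ≡ 0 → b ≤ Δ
  up≡0⇒small {b} up≡0 = ≮⇒≥ (λ Δ<b → <⇒≢ (≤-trans (s≤s z≤n) (≤-trans 2≤Δ (pred-mono-≤ Δ<b)))
    (sym (trans (sym (up-large (<⇒≱ Δ<b))) up≡0)))

  private
    degree≤ : ∀ v ns → (∀ {u} → Adjacent v u → toℕ u ∈ ns) → degree v ≤ length ns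
    degree≤ v ns inside = ≤-trans (≤-reflexive (sym (length-map toℕ (neighbours v))))
      (unique-⊆⇒length≤ (Unique.map⁺ toℕ-injective (neighbours-unique v)) inside′)
      where
      inside′ : ∀ {x} → x ∈ map toℕ (neighbours v) → x ∈ ns
      inside′ x∈ with ∈-map⁻ toℕ x∈
      ... | u , u∈ , refl = inside (T-does⁻ (adjacent? v u) (∈-neighbours⁻ u∈))

    leaves : List ℕ
    leaves = map suc (upTo Δ)

    length-leaves : length leaves ≡ Δ
    length-leaves = trans (length-map suc (upTo Δ)) (List.length-upTo Δ)

    degree≤Δ : ∀ v → degree v ≤ Δ
    degree≤Δ v with toℕ v ≟ 0
    ... | yes v≡0 = ≤-trans (degree≤ v leaves inside) (≤-reflexive length-leaves)
      where
      inside : ∀ {u} → Adjacent v u → toℕ u ∈ leaves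
      inside {u} (inj₁ (0<u , up≡)) = subst (_∈ leaves) (suc-pred (toℕ u) {{>-nonZero 0<u}})
        (∈-map⁺ suc (∈-upTo⁺ (≤-trans (≤-reflexive (suc-pred (toℕ u) {{>-nonZero 0<u}}))
            (up≡0⇒small (trans up≡ v≡0)))))
      inside (inj₂ (0<v , _)) = ⊥-elim (<⇒≢ 0<v (sym v≡0))
    ... | no v≢0 = ≤-trans (degree≤ v (up (toℕ v) ∷ suc (toℕ v) ∷ []) inside) 2≤Δ
      where
      inside : ∀ {u} → Adjacent v u → toℕ u ∈ up (toℕ v) ∷ suc (toℕ v) ∷ []
      inside {u} (inj₁ (0<u , up≡)) with toℕ u ≤? Δ
      ... | yes u≤Δ = ⊥-elim (v≢0 (trans (sym up≡) (up-small u≤Δ)))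
      ... | no u≰Δ  = there
          (here (trans (sym (suc-pred (toℕ u) {{>-nonZero 0<u}}))
              (cong suc (trans (sym (up-large u≰Δ)) up≡))))
      inside (inj₂ (_ , up≡)) = here (sym up≡)

    Δ≤degree-centre : Δ ≤ degree centre
    Δ≤degree-centre = begin
      Δ                                       ≡⟨ length-leaves ⟨
      length leaves
          ≤⟨ unique-⊆⇒length≤ (Unique.map⁺ suc-injective (Unique.upTo⁺ Δ)) inside ⟩
      length (map toℕ (neighbours centre))    ≡⟨ length-map toℕ (neighbours centre) ⟩
      degree centre                           ∎
      where
      open ≤-Reasoning
      inside : ∀ {x} → x ∈ leaves → x ∈ map toℕ (neighbours centre)
      inside x∈ with ∈-map⁻ suc x∈
      ... | y , y∈ , refl = subst (_∈ map toℕ (neighbours centre)) toℕ-u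
            (∈-map⁺ toℕ (∈-neighbours⁺ (T-does⁺ (adjacent? centre u)
              (inj₁ (subst (0 <_) (sym toℕ-u) (s≤s z≤n) , trans (cong up toℕ-u)
                  (trans (up-small y<Δ) (sym toℕ-centre)))))))
        where
        y<Δ : y < Δ
        y<Δ = ∈-upTo⁻ y∈
        u : Fin N
        u = fromℕ< (≤-<-trans y<Δ Δ<N)
        toℕ-u : toℕ u ≡ suc y
        toℕ-u = toℕ-fromℕ< _

  maxDegree-broom : maxDegree ≡ Δ
  maxDegree-broom = ≤-antisym
    (max≤v⁺ z≤n (All.map⁺ {xs = allFin N} (All.tabulate (λ {v} _ → degree≤Δ v))))
    (≤-trans Δ≤degree-centre (degree≤maxDegree centre))

  -- Leaves are the nodes 1, …, Δ, except Δ if the path goes on.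
  Leaf : Fin N → Set
  Leaf v = 0 < toℕ v × toℕ v ≤ Δ × (suc (toℕ v) ≤ Δ ⊎ N ≡ suc Δ)

  leaf-neighbours : ∀ {v} → Leaf v → ∀ x → joined v x ≡ does (toℕ x ≟ 0)
  leaf-neighbours {v} (0<v , v≤Δ , no-child) x = does-cong (adjacent? v x) (toℕ x ≟ 0) only-centre
      (λ x≡0 → inj₂ (0<v , trans (up-small v≤Δ) (sym x≡0)))
    where
    only-centre : Adjacent v x → toℕ x ≡ 0
    only-centre (inj₂ (_ , up≡)) = trans (sym up≡) (up-small v≤Δ)
    only-centre (inj₁ (0<x , up≡)) = ⊥-elim (absurd (toℕ x ≤? Δ))
      where
      absurd : Dec (toℕ x ≤ Δ) → ⊥
      absurd (yes x≤Δ) = <⇒≢ 0<v (trans (sym (up-small x≤Δ)) up≡)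
      absurd (no x≰Δ)  = [ (λ 1+v≤Δ → x≰Δ (subst (_≤ Δ) (sym x≡1+v) 1+v≤Δ)) ,
                           (λ N≡ → x≰Δ (≤-pred (subst (toℕ x <_) N≡ (toℕ<n x)))) ]′ no-child
        where
        x≡1+v : toℕ x ≡ suc (toℕ v)
        x≡1+v = trans (sym (suc-pred (toℕ x) {{>-nonZero 0<x}})) (cong suc (trans (sym (up-large x≰Δ)) up≡))

  -- The sources are the nodes s, …, s + k - 1, the sink is the centre.
  module _ (s k : ℕ) (s+k≤N : s + k ≤ N) where

    private
      place : Fin k → Fin N
      place i = fromℕ< (<-≤-trans (+-monoʳ-< s (toℕ<n i)) s+k≤N)

    toℕ-place : ∀ i → toℕ (place i) ≡ s + toℕ i
    toℕ-place i = toℕ-fromℕ< _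

    broomInstance : Instance k
    broomInstance = record
      { network          = broom
      ; source           = place
      ; source-injective = λ {i} {j} eq → toℕ-injective
          (+-cancelˡ-≡ s _ _ (trans (sym (toℕ-place i)) (trans (cong toℕ eq) (toℕ-place j))))
      ; sink             = centre
      }

    module _ (scheme : LabelingScheme) (alg : Algorithm)
        (gathered : Gathers alg broomInstance (scheme broomInstance)) where
      open Indistinguishable alg broomInstance (scheme broomInstance)

      -- Leaves are twins, and a message that stays at its source does not reach
      -- the centre.
      leaf-labels : ∀ {q} (f : Fin q → Fin k) → (∀ {i j} → f i ≡ f j → i ≡ j) → (∀ i → Leaf (place (f i))) →
        q < 2 ^ suc (schemeLength scheme broomInstance)
      leaf-labels {q} f f-injective leaf = distinct-labels (schemeLength scheme broomInstance)
          (λ i → scheme broomInstance (place (f i))) injective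
        (λ i → label≤schemeLength scheme broomInstance (place (f i)))
        where
        injective : ∀ {i j} → scheme broomInstance (place (f i)) ≡ scheme broomInstance (place (f j)) →
            i ≡ j
        injective {i} {j} eq with i ≟ᶠ j
        ... | yes i≡j = i≡j
        ... | no i≢j  = ⊥-elim (<⇒≢ (proj₁ (leaf i)) (sym (trans (cong toℕ stays) toℕ-centre)))
          where
          stays : place (f i) ≡ centre
          stays = twin-message-stays (i≢j ∘ f-injective)
            (λ x → trans (leaf-neighbours (leaf i) x) (sym (leaf-neighbours (leaf j) x))) eq
            (proj₁ gathered) (proj₂ gathered (f i))

      -- If all nodes are sources, then not all labels are empty: the message of
      -- node 1 has to reach node 0.
      nonempty-label : s ≡ 0 → N ≡ k → 1 ≤ schemeLength scheme broomInstance
      nonempty-label s≡0 N≡k = n≢0⇒n>0 (λ L≡0 → <⇒≢ (s≤s z≤n) (sym (begin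
          1                 ≡⟨ trans (cong (_+ 1) (sym s≡0)) (cong (s +_) (sym (toℕ-fromℕ< 1<k))) ⟩
          s + toℕ (fromℕ< 1<k)       ≡⟨ toℕ-place (fromℕ< 1<k) ⟨
          toℕ (place (fromℕ< 1<k))
              ≡⟨ cong toℕ (uniform-message-stays all-sources (same-labels L≡0) (proj₁ gathered)
                  (proj₂ gathered (fromℕ< 1<k))) ⟩
          toℕ centre        ≡⟨ toℕ-centre ⟩
          0                 ∎)))
        where
        open ≡-Reasoning
        1<k : 1 < k
        1<k = ≤-trans 2≤Δ (≤-trans (<⇒≤ Δ<N) (≤-reflexive N≡k))
        all-sources : ∀ x → ∃ λ i → place i ≡ x
        all-sources x = fromℕ< x<k , toℕ-injective
            (trans (toℕ-place (fromℕ< x<k)) (trans (cong (_+ toℕ (fromℕ< x<k)) s≡0) (toℕ-fromℕ< x<k)))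
          where
          x<k : toℕ x < k
          x<k = subst (toℕ x <_) N≡k (toℕ<n x)
        empty : schemeLength scheme broomInstance ≡ 0 → ∀ x → scheme broomInstance x ≡ []
        empty L≡0 x with scheme broomInstance x | label≤schemeLength scheme broomInstance x
        ... | []    | _  = refl
        ... | _ ∷ _ | le = ⊥-elim (<⇒≱ (s≤s z≤n) (≤-trans le (≤-reflexive L≡0)))
        same-labels : schemeLength scheme broomInstance ≡ 0 → ∀ x y →
            scheme broomInstance x ≡ scheme broomInstance y
        same-labels L≡0 x y = trans (empty L≡0 x) (sym (empty L≡0 y))

-- The two bounds

tree-scheme : LabelingScheme
tree-scheme {zero}  I = λ _ → []
tree-scheme {suc K} I = Labelling.Run.label I

upper-bound : ∀ (k : ℕ) → 1 ≤ k → (I : Instance k) → (D : ℕ) → Instance.IsDiameter I D →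
    1 ≤ Instance.maxDegree I →
  (schemeLength tree-scheme I ≤ 34 * (1 + (⌊log₂ Instance.maxDegree I ⌋ ⊓ ⌊log₂ k ⌋)))
  × GathersWithin relaying I (tree-scheme I) (34 * ((D + k) ⊓ (D * Instance.maxDegree I)))
upper-bound (suc K) _ I D isD 1≤Δ =
  max≤v⁺ z≤n (All.map⁺ {xs = allFin (Instance.size I)} (All.tabulate (λ {v} _ → label-short 1≤Δ v))) ,
  gathers 1≤Δ isD
  where open Labelling I

½*≤ : ∀ {x L} → x ≤ 2 * L → ½ *ℚ fromℕ x ≤ℚ fromℕ L
½*≤ {x} {L} x≤2L = ℚ.toℚᵘ-cancel-≤ (begin
  toℚᵘ (½ *ℚ fromℕ x)               ≃⟨ ℚ.toℚᵘ-homo-* ½ (fromℕ x) ⟩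
  toℚᵘ ½ ℚᵘ.* toℚᵘ (fromℕ x)      ≃⟨ ℚᵘ.*-congˡ (ℚ.toℚᵘ-fromℚᵘ (mkℚᵘ (ℤ.+ x) 0)) ⟩
  toℚᵘ ½ ℚᵘ.* mkℚᵘ (ℤ.+ x) 0          ≤⟨ *≤* in-integers ⟩
  mkℚᵘ (ℤ.+ L) 0                        ≃⟨ ℚ.toℚᵘ-fromℚᵘ (mkℚᵘ (ℤ.+ L) 0) ⟨
  toℚᵘ (fromℕ L)                    ∎)
  where
  open ℚᵘ.≤-Reasoning
  in-integers : ℤ.+ 1 ℤ.* ℤ.+ x ℤ.* ℤ.+ 1 ℤ.≤ ℤ.+ L ℤ.* ℤ.+ 2
  in-integers rewrite ℤ.*-identityʳ (ℤ.+ 1 ℤ.* ℤ.+ x) | ℤ.*-identityˡ (ℤ.+ x) | sym (ℤ.pos-* L 2) =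
    ℤ.+≤+ (≤-trans x≤2L (≤-reflexive (*-comm 2 L)))

⌈log₂⌉≤ : ∀ {x L} → x ≤ 2 ^ suc L → 1 ≤ L → ⌈log₂ x ⌉ ≤ 2 * L
⌈log₂⌉≤ {x} {L} x≤ 1≤L = begin
  ⌈log₂ x ⌉          ≤⟨ ⌈log₂⌉-mono-≤ x≤ ⟩
  ⌈log₂ 2 ^ suc L ⌉  ≡⟨ ⌈log₂2^n⌉≡n (suc L) ⟩
  1 + L              ≤⟨ +-mono-≤ 1≤L (m≤m+n L 0) ⟩
  2 * L              ∎
  where open ≤-Reasoning

module _ {k Δ : ℕ} (1≤k : 1 ≤ k) (2≤Δ : 2 ≤ Δ) where

  -- The instance I has maximum degree Δ and forces long labels.
  Demanding : Instance k → Set₁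
  Demanding I = (Instance.maxDegree I ≡ Δ) ×
    (∀ (scheme : LabelingScheme) (alg : Algorithm) → Gathers alg I (scheme I) →
      (½ *ℚ fromℕ (⌈log₂ Δ ⌉ ⊓ ⌈log₂ k ⌉)) ≤ℚ fromℕ (schemeLength scheme I))

  -- A star with Δ leaves, k of which are sources.
  few-sources : k ≤ Δ → Σ (Instance k) Demanding
  few-sources k≤Δ = I , maxDegree-broom , λ scheme alg gathered →
    ½*≤ {L = schemeLength scheme I} (≤-trans (m⊓n≤n ⌈log₂ Δ ⌉ ⌈log₂ k ⌉)
      (bound 1≤k (schemeLength scheme I) (leaf-labels 1 k (s≤s k≤Δ) scheme alg gathered id id leaf)))
    where
    open Broom Δ (suc Δ) 2≤Δ ≤-refl
    I : Instance k
    I = broomInstance 1 k (s≤s k≤Δ)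
    leaf : ∀ i → Leaf (Instance.source I i)
    leaf i rewrite toℕ-place 1 k (s≤s k≤Δ) i = s≤s z≤n , ≤-trans (toℕ<n i) k≤Δ , inj₂ refl
    -- Two or more distinct labels cannot all be empty.
    bound : ∀ {k} → 1 ≤ k → ∀ L → k < 2 ^ suc L → ⌈log₂ k ⌉ ≤ 2 * L
    bound {1} _ L _ = z≤n
    bound {suc (suc k)} _ zero    k<2 = ⊥-elim (<⇒≱ k<2 (s≤s (s≤s z≤n)))
    bound {suc (suc k)} _ (suc L) k<  = ⌈log₂⌉≤ (<⇒≤ k<) (s≤s z≤n)

  -- A broom with k nodes, all of which are sources.
  many-sources : Δ < k → Σ (Instance k) Demanding
  many-sources Δ<k = I , maxDegree-broom , λ scheme alg gathered →
    ½*≤ {L = schemeLength scheme I} (≤-trans (m⊓n≤m ⌈log₂ Δ ⌉ ⌈log₂ k ⌉)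
      (⌈log₂⌉≤ {L = schemeLength scheme I} (many-labels scheme alg gathered)
        (nonempty-label 0 k ≤-refl scheme alg gathered refl refl)))
    where
    open Broom Δ k 2≤Δ Δ<k
    I : Instance k
    I = broomInstance 0 k ≤-refl
    1+predΔ : suc (pred Δ) ≡ Δ
    1+predΔ = suc-pred Δ {{>-nonZero (<⇒≤ 2≤Δ)}}
    -- Node Δ starts the path; if the path has further nodes, then only the
    -- nodes 1, …, Δ - 1 are leaves.
    number : Fin (pred Δ) → Fin k
    number i = fromℕ< (≤-<-trans (≤-trans (toℕ<n i) pred[n]≤n) Δ<k)
    toℕ-number : ∀ i → toℕ (number i) ≡ suc (toℕ i)
    toℕ-number i = toℕ-fromℕ< _
    number-injective : ∀ {i j} → number i ≡ number j → i ≡ j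
    number-injective {i} {j} eq = toℕ-injective (suc-injective
      (trans (sym (toℕ-number i)) (trans (cong toℕ eq) (toℕ-number j))))
    leaf : ∀ i → Leaf (Instance.source I (number i))
    leaf i rewrite toℕ-place 0 k ≤-refl (number i) | toℕ-number i = s≤s z≤n , <⇒≤ i<Δ , inj₁ i<Δ
      where
      i<Δ : suc (suc (toℕ i)) ≤ Δ
      i<Δ = ≤-trans (s≤s (toℕ<n i)) (≤-reflexive 1+predΔ)
    many-labels : ∀ (scheme : LabelingScheme) (alg : Algorithm) → Gathers alg I (scheme I) →
      Δ ≤ 2 ^ suc (schemeLength scheme I)
    many-labels scheme alg gathered = ≤-trans (≤-reflexive (sym 1+predΔ))
      (leaf-labels 0 k ≤-refl scheme alg gathered number number-injective leaf)

  lower-bound : Σ (Instance k) Demanding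
  lower-bound = [ few-sources , many-sources ]′ (≤-<-connex k Δ)

open Instance using (maxDegree; IsDiameter)

corollary1 : (Σ ℕ λ C → Σ LabelingScheme λ scheme → Σ Algorithm λ alg →
    ∀ (k : ℕ) → 1 ≤ k → (I : Instance k) → (D : ℕ) → IsDiameter I D → 1 ≤ maxDegree I →
    (schemeLength scheme I ≤ C * (1 + (⌊log₂ maxDegree I ⌋ ⊓ ⌊log₂ k ⌋)))
    × GathersWithin alg I (scheme I) (C * ((D + k) ⊓ (D * maxDegree I))))
    ×
    (Σ ℚ λ c → (0ℚ <ℚ c) ×
    (∀ (k Δ : ℕ) → 1 ≤ k → 2 ≤ Δ →
    Σ (Instance k) λ I → (maxDegree I ≡ Δ) ×
    (∀ (scheme : LabelingScheme) (alg : Algorithm) → Gathers alg I (scheme I) →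
    (c *ℚ fromℕ (⌈log₂ Δ ⌉ ⊓ ⌈log₂ k ⌉)) ≤ℚ fromℕ (schemeLength scheme I))))
corollary1 =
  (34 , tree-scheme , relaying , upper-bound) ,
  (½ , ℚ.positive⁻¹ ½ , λ k Δ → lower-bound)
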